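{- The model checking problem for $\exists\mathrm{TeamCTL}(\vee_{\mathrm B})$ is $\Sigma^1_1$-hard.
   Context: Fix a set $\mathsf{AP}$ of atomic propositions. A trace is an infinite sequence $t\in(2^{\mathsf{AP}})^\omega$. A multiset is a set of pairs (index, element) with pairwise distinct indices; the index is usually dropped. $T=T_1\uplus T_2$ means that $T$ is partitioned into $T_1$ and $T_2$ (either may be empty). A rooted Kripke structure is $\mathfrak K=(W,R,\eta,r)$ with $W$ a finite non-empty set of states, $R\subseteq W^2$ left-total, $\eta\colon W\to 2^{\mathsf{AP}}$, $r\in W$. A path is $\sigma\in W^\omega$ with $\sigma[0]=r$ and $(\sigma[i],\sigma[i+1])\in R$ for all $i$; its trace is $t(\sigma)=\eta(\sigma[0])\eta(\sigma[1])\cdots$. $\mathrm{Traces}(\mathfrak K)$ is the multiset $\{(\sigma,t(\sigma))\mid\sigma\text{ a path through }\mathfrak K\}$ (indexed by paths). Tefs: for a multiset of traces $T$ and $\tau\colon\mathbb N\times T\to\mathbb N$, write $\tau(i)=(\tau(i,t))_{t\in T}$; for tuples, $\vec a\le\vec b$ is componentwise, and $\vec a<\vec b$ means $\vec a\le\vec b$ and $\vec a\ne\vec b$. $\tau$ is a tef (time evaluation function) for $T$ if for all $i$: $\tau(i)<\tau(i+1)$ and $\tau(i)\le\tau(i+1)\le\tau(i)+\vec 1$; a stuttering tef if for all $i$: $\tau(i)\le\tau(i+1)\le\tau(i)+\vec 1$; it is initial if $\tau(0,t)=0$ for all $t$. $\exists\mathrm{TeamCTL}(\vee_{\mathrm B})$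 formulae (where $\vee_{\mathrm B}$ is the Boolean disjunction, distinct from $\lor$): $\varphi ::= p\mid\neg p\mid(\varphi\lor\varphi)\mid(\varphi\land\varphi)\mid(\varphi\vee_{\mathrm B}\varphi)\mid\mathsf X_\exists\varphi\mid[\varphi\,\mathsf U_\exists\,\varphi]\mid[\varphi\,\mathsf W_\exists\,\varphi]$, with $p\in\mathsf{AP}$; $\mathsf X_\exists\varphi$, $[\varphi\,\mathsf U_\exists\,\psi]$, $[\varphi\,\mathsf W_\exists\,\psi]$ abbreviate $\exists\mathsf X\varphi$, $\exists[\varphi\,\mathsf U\,\psi]$, $\exists[\varphi\,\mathsf W\,\psi]$. Semantics, for $\tau$ a stuttering tef for $T$ and $i\in\mathbb N$: $(T,\tau,i)\models p$ iff $p\in t[\tau(i,t)]$ for all $t\in T$; $(T,\tau,i)\models\neg p$ iff $p\notin t[\tau(i,t)]$ for all $t\in T$; $\land$ is conjunction; $(T,\tau,i)\models(\varphi\lor\psi)$ iff there are $T_1\uplus T_2=T$ with $(T_1,\tau,i)\models\varphi$ and $(T_2,\tau,i)\models\psi$ (with $\tau$ restricted accordingly); $(T,\tau,i)\models(\varphi\vee_{\mathrm B}\psi)$ iff $(T,\tau,i)\models\varphi$ or $(T,\tau,i)\models\psi$; $(T,\tau,i)\models\mathsf X\varphi$ iff $(T,\tau,i+1)\models\varphi$; $(T,\tau,i)\models[\varphi\,\mathsf U\,\psi]$ iff there is $k\ge i$ with $(T,\tau,k)\models\psi$ and $(T,\tau,m)\models\varphi$ for all $i\le m<k$; $(T,\tau,i)\models[\varphi\,\mathsf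 W\,\psi]$ iff for all $k\ge i$, $(T,\tau,k)\models\varphi$ or there is $m$ with $i\le m\le k$ and $(T,\tau,m)\models\psi$; $(T,\tau,i)\models\exists\varphi$ iff $(T,\tau',i)\models\varphi$ for some tef $\tau'$ for $T$ with $\tau'(j,t)=\tau(j,t)$ for all $j\le i$, $t\in T$. $T\models_\exists\varphi$ means $(T,\tau,0)\models\varphi$ for some initial tef $\tau$ for $T$. The model checking problem: given a formula $\varphi$ and a Kripke structure $\mathfrak K$, does $\mathrm{Traces}(\mathfrak K)\models_\exists\varphi$ hold? -}

module Defs where

open import Level using (0ℓ)
open import Data.Bool using (Bool; true; false; not) renaming (T to IsTrue)
open import Data.Empty using (⊥-elim)
open import Data.Fin using (Fin; toℕ)
open import Data.Fin.Properties using (toℕ-injective)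
open import Data.List using (List; []; _∷_)
open import Data.List.Membership.Propositional using (_∈_)
open import Data.Nat using (ℕ; zero; suc; pred; _+_; _*_; _≤_; _<_; z≤n; s≤s)
open import Data.Nat.Properties
  using (+-comm; +-cancelˡ-≡; +-cancelʳ-≡; +-monoʳ-≤; m≤n+m; m≤m+n;
         ≤-refl; ≤-trans; ≤-reflexive; <-cmp; <⇒≢; m≤n⇒m<n∨m≡n)
open import Data.Product using (Σ-syntax; ∃-syntax; _×_; _,_; proj₁)
open import Data.Sum using (_⊎_; inj₁; inj₂)
open import Data.Vec using (Vec; []; _∷_; lookup)
open import Data.Vec.Relation.Binary.Pointwise.Inductive using (Pointwise)
open import Function using (_∘_)
open import Function.Bundles using (_⇔_; _↣_; mk↣; Injection)
open import Function.Definitions using (Injective)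
open import Relation.Binary.Definitions using (tri<; tri≈; tri>)
open import Relation.Binary.PropositionalEquality
  using (_≡_; _≗_; refl; sym; trans; cong; cong₂)
open import Relation.Nullary using (¬_)
open import Relation.Unary using (Pred)

-- Countably many propositions; a formula or a finite structure uses only
-- finitely many of them.
AP : Set
AP = ℕ

Trace : Set₁
Trace = ℕ → Pred AP 0ℓ

-- A multiset: the elements of Index are the (pairwise distinct) indices.
record Team : Set₁ where
  field
    Index : Set
    trace : Index → Trace

open Team public

_↾_ : (𝒯 : Team) → (Index 𝒯 → Bool) → Team
𝒯 ↾ S = record
  { Index = Σ[ t ∈ Index 𝒯 ] IsTrue (S t)
  ; trace = λ t → trace 𝒯 (proj₁ t)
  }

TimeEval : Team → Set
TimeEval 𝒯 = ℕ → Index 𝒯 → ℕ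

restrict : ∀ {𝒯} (S : Index 𝒯 → Bool) → TimeEval 𝒯 → TimeEval (𝒯 ↾ S)
restrict S τ i t = τ i (proj₁ t)

module _ {I : Set} where

  infix 4 _≤ᵗ_ _<ᵗ_

  _≤ᵗ_ : (I → ℕ) → (I → ℕ) → Set
  a ≤ᵗ b = ∀ t → a t ≤ b t

  _<ᵗ_ : (I → ℕ) → (I → ℕ) → Set
  a <ᵗ b = a ≤ᵗ b × ¬ (a ≗ b)

  _+1ᵗ : (I → ℕ) → (I → ℕ)
  (a +1ᵗ) t = a t + 1

IsStutteringTef : (𝒯 : Team) → TimeEval 𝒯 → Set
IsStutteringTef 𝒯 τ = ∀ i → τ i ≤ᵗ τ (suc i) × τ (suc i) ≤ᵗ τ i +1ᵗ

-- The empty team has no tef, since its tuples are all equal.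
IsTef : (𝒯 : Team) → TimeEval 𝒯 → Set
IsTef 𝒯 τ = (∀ i → τ i <ᵗ τ (suc i)) × IsStutteringTef 𝒯 τ

IsInitial : (𝒯 : Team) → TimeEval 𝒯 → Set
IsInitial 𝒯 τ = ∀ t → τ 0 t ≡ 0

data Formula : Set where
  pos neg                  : AP → Formula
  _∨′_ _∧′_ _∨ᴮ_           : Formula → Formula → Formula
  X∃_                      : Formula → Formula
  [_U∃_] [_W∃_]            : Formula → Formula → Formula

-- The quantifier ∃ at time i, applied to a property of time evaluation
-- functions.
SomeTef : (𝒯 : Team) → TimeEval 𝒯 → ℕ → (TimeEval 𝒯 → Set) → Set
SomeTef 𝒯 τ i P =
  ∃[ τ′ ] IsTef 𝒯 τ′ × (∀ j → j ≤ i → ∀ t → τ′ j t ≡ τ j t) × P τ′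

-- Meant for stuttering tefs τ only; the clauses make sense for an arbitrary τ
-- and preserve "τ is a stuttering tef", since tefs and
-- restrictions of stuttering tefs are stuttering tefs.
infix 3 ⟨_,_,_⟩⊨_

⟨_,_,_⟩⊨_ : (𝒯 : Team) → TimeEval 𝒯 → ℕ → Formula → Set
⟨ 𝒯 , τ , i ⟩⊨ pos p    = ∀ t → trace 𝒯 t (τ i t) p
⟨ 𝒯 , τ , i ⟩⊨ neg p    = ∀ t → ¬ trace 𝒯 t (τ i t) p
⟨ 𝒯 , τ , i ⟩⊨ (φ ∨′ ψ) =
  Σ[ S ∈ (Index 𝒯 → Bool) ]
    (⟨ 𝒯 ↾ S , restrict {𝒯} S τ , i ⟩⊨ φ) ×
    (⟨ 𝒯 ↾ (not ∘ S) , restrict {𝒯} (not ∘ S) τ , i ⟩⊨ ψ)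
⟨ 𝒯 , τ , i ⟩⊨ (φ ∧′ ψ) = (⟨ 𝒯 , τ , i ⟩⊨ φ) × (⟨ 𝒯 , τ , i ⟩⊨ ψ)
⟨ 𝒯 , τ , i ⟩⊨ (φ ∨ᴮ ψ) = (⟨ 𝒯 , τ , i ⟩⊨ φ) ⊎ (⟨ 𝒯 , τ , i ⟩⊨ ψ)
⟨ 𝒯 , τ , i ⟩⊨ (X∃ φ)   = SomeTef 𝒯 τ i λ τ′ → ⟨ 𝒯 , τ′ , suc i ⟩⊨ φ
⟨ 𝒯 , τ , i ⟩⊨ [ φ U∃ ψ ] = SomeTef 𝒯 τ i λ τ′ →
  ∃[ k ] i ≤ k × (⟨ 𝒯 , τ′ , k ⟩⊨ ψ) ×
         (∀ m → i ≤ m → m < k → ⟨ 𝒯 , τ′ , m ⟩⊨ φ)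
⟨ 𝒯 , τ , i ⟩⊨ [ φ W∃ ψ ] = SomeTef 𝒯 τ i λ τ′ →
  ∀ k → i ≤ k →
    (⟨ 𝒯 , τ′ , k ⟩⊨ φ) ⊎
    (∃[ m ] i ≤ m × m ≤ k × (⟨ 𝒯 , τ′ , m ⟩⊨ ψ))

infix 3 _⊨∃_

_⊨∃_ : Team → Formula → Set
𝒯 ⊨∃ φ = ∃[ τ ] IsTef 𝒯 τ × IsInitial 𝒯 τ × (⟨ 𝒯 , τ , 0 ⟩⊨ φ)

-- The states are numbered, R is given by its adjacency matrix, and each label
-- is a finite set of propositions given as a list, of which only membership is
-- used.  The root makes the set of states non-empty.  Totality is irrelevant so
-- that its proof does not distinguish structures.
record Kripke : Set where
  field
    size   : ℕ
    R      : Vec (Vec Bool size) size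
    η      : Vec (List AP) size
    root   : Fin size

  State : Set
  State = Fin size

  _⟶_ : State → State → Set
  w ⟶ v = IsTrue (lookup (lookup R w) v)

  field
    .total : ∀ w → ∃[ v ] w ⟶ v

module _ (K : Kripke) where
  open Kripke K

  record Path : Set where
    field
      σ     : ℕ → State
      start : σ 0 ≡ root
      step  : ∀ i → σ i ⟶ σ (suc i)

  Traces : Team
  Traces = record
    { Index = Path
    ; trace = λ π i p → p ∈ lookup η (Path.σ π i)
    }

Instance : Set
Instance = Formula × Kripke

ModelChecking : Pred Instance 0ℓ
ModelChecking (φ , K) = Traces K ⊨∃ φ

-- Programs for the partial μ-recursive functions, by arity.
data Rec : ℕ → Set where
  zer  : ∀ {n} → Rec n
  succ : Rec 1
  proj : ∀ {n} → Fin n → Rec n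
  comp : ∀ {m n} → Rec m → Vec (Rec n) m → Rec n
  prec : ∀ {n} → Rec n → Rec (suc (suc n)) → Rec (suc n)
  mu   : ∀ {n} → Rec (suc n) → Rec n

infix 4 _[_]⇓_

data _[_]⇓_ : ∀ {n} → Rec n → Vec ℕ n → ℕ → Set where
  ⇓zer   : ∀ {n} {xs : Vec ℕ n} → zer [ xs ]⇓ 0
  ⇓succ  : ∀ {x} → succ [ x ∷ [] ]⇓ suc x
  ⇓proj  : ∀ {n} {i : Fin n} {xs} → proj i [ xs ]⇓ lookup xs i
  ⇓comp  : ∀ {m n} {f : Rec m} {gs : Vec (Rec n) m} {xs ys z} →
           Pointwise (λ g y → g [ xs ]⇓ y) gs ys → f [ ys ]⇓ z →
           comp f gs [ xs ]⇓ z
  ⇓prec0 : ∀ {n} {f : Rec n} {g xs z} →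
           f [ xs ]⇓ z → prec f g [ 0 ∷ xs ]⇓ z
  ⇓precS : ∀ {n} {f : Rec n} {g x xs y z} →
           prec f g [ x ∷ xs ]⇓ y → g [ x ∷ y ∷ xs ]⇓ z →
           prec f g [ suc x ∷ xs ]⇓ z
  ⇓mu    : ∀ {n} {f : Rec (suc n)} {xs y} →
           f [ y ∷ xs ]⇓ 0 →
           (∀ z → z < y → ∃[ v ] f [ z ∷ xs ]⇓ suc v) →
           mu f [ xs ]⇓ y

Computable : (ℕ → ℕ) → Set
Computable f = Σ[ e ∈ Rec 1 ] ∀ n → e [ n ∷ [] ]⇓ f n

-- Arithmetical formulas with k free set variables and m free number variables
-- (de Bruijn indices for the latter).

data Term (m : ℕ) : Set where
  var       : Fin m → Term m
  𝟎         : Term m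
  𝐬         : Term m → Term m
  _⊕_ _⊗_   : Term m → Term m → Term m

data Arith (k : ℕ) : ℕ → Set where
  _≐_       : ∀ {m} → Term m → Term m → Arith k m
  _∈̇_       : ∀ {m} → Term m → Fin k → Arith k m
  ¬̇_        : ∀ {m} → Arith k m → Arith k m
  _∧̇_ _∨̇_   : ∀ {m} → Arith k m → Arith k m → Arith k m
  ∀̇_ ∃̇_     : ∀ {m} → Arith k (suc m) → Arith k m

⟦_⟧ᵗ : ∀ {m} → Term m → Vec ℕ m → ℕ
⟦ var i ⟧ᵗ ρ = lookup ρ i
⟦ 𝟎     ⟧ᵗ ρ = 0
⟦ 𝐬 s   ⟧ᵗ ρ = suc (⟦ s ⟧ᵗ ρ)
⟦ s ⊕ t ⟧ᵗ ρ = ⟦ s ⟧ᵗ ρ + ⟦ t ⟧ᵗ ρ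
⟦ s ⊗ t ⟧ᵗ ρ = ⟦ s ⟧ᵗ ρ * ⟦ t ⟧ᵗ ρ

⟦_⟧ : ∀ {k m} → Arith k m → (Fin k → ℕ → Bool) → Vec ℕ m → Set
⟦ s ≐ t ⟧ Xs ρ = ⟦ s ⟧ᵗ ρ ≡ ⟦ t ⟧ᵗ ρ
⟦ s ∈̇ X ⟧ Xs ρ = IsTrue (Xs X (⟦ s ⟧ᵗ ρ))
⟦ ¬̇ α   ⟧ Xs ρ = ¬ ⟦ α ⟧ Xs ρ
⟦ α ∧̇ β ⟧ Xs ρ = ⟦ α ⟧ Xs ρ × ⟦ β ⟧ Xs ρ
⟦ α ∨̇ β ⟧ Xs ρ = ⟦ α ⟧ Xs ρ ⊎ ⟦ β ⟧ Xs ρ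
⟦ ∀̇ α   ⟧ Xs ρ = ∀ n → ⟦ α ⟧ Xs (n ∷ ρ)
⟦ ∃̇ α   ⟧ Xs ρ = ∃[ n ] ⟦ α ⟧ Xs (n ∷ ρ)

-- Definable by ∃X₁ … ∃X_k α with α arithmetical; sets of numbers are given by
-- characteristic functions, which under excluded middle are all of them.
Σ¹₁ : Pred ℕ 0ℓ → Set
Σ¹₁ A = ∃[ k ] Σ[ α ∈ Arith k 1 ] ∀ n →
  A n ⇔ (Σ[ Xs ∈ (Fin k → ℕ → Bool) ] ⟦ α ⟧ Xs (n ∷ []))

-- Hardness under computable many-one reductions for a problem whose instances
-- are encoded by natural numbers.
Σ¹₁-Hard : {I : Set} → I ↣ ℕ → Pred I 0ℓ → Set₁
Σ¹₁-Hard {I} encoding P =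
  ∀ (A : Pred ℕ 0ℓ) → Σ¹₁ A →
  Σ[ f ∈ (ℕ → I) ]
    Computable (λ n → Injection.to encoding (f n)) × (∀ n → A n ⇔ P (f n))

triangle : ℕ → ℕ
triangle zero    = 0
triangle (suc n) = suc n + triangle n

-- Cantor's pairing function.
pair : ℕ → ℕ → ℕ
pair x y = triangle (x + y) + y

private
  triangle-mono : ∀ {m n} → m ≤ n → triangle m ≤ triangle n
  triangle-mono {n = zero}  z≤n = ≤-refl
  triangle-mono {m} {suc n} m≤ with m≤n⇒m<n∨m≡n m≤
  ... | inj₂ refl = ≤-refl
  ... | inj₁ (s≤s m≤n) =
    ≤-trans (triangle-mono m≤n) (m≤n+m (triangle n) (suc n))

  pair-< : ∀ {x y x′ y′} → x + y < x′ + y′ → pair x y < pair x′ y′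
  pair-< {x} {y} {x′} {y′} lt =
    ≤-trans (≤-trans below (triangle-mono lt)) (m≤m+n _ y′)
    where
    below : pair x y < triangle (suc (x + y))
    below = s≤s (≤-trans (+-monoʳ-≤ (triangle (x + y)) (m≤n+m y x))
                             (≤-reflexive (+-comm (triangle (x + y)) (x + y))))

pair-injective : ∀ {x y x′ y′} → pair x y ≡ pair x′ y′ → x ≡ x′ × y ≡ y′
pair-injective {x} {y} {x′} {y′} eq with <-cmp (x + y) (x′ + y′)
... | tri< lt _ _ = ⊥-elim (<⇒≢ (pair-< {x} {y} {x′} {y′} lt) eq)
... | tri> _ _ gt = ⊥-elim (<⇒≢ (pair-< {x′} {y′} {x} {y} gt) (sym eq))
... | tri≈ _ sums _ = x≡x′ , y≡y′
  where
  y≡y′ : y ≡ y′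
  y≡y′ = +-cancelˡ-≡ (triangle (x + y)) y y′
           (trans eq (cong (λ s → triangle s + y′) (sym sums)))
  x≡x′ : x ≡ x′
  x≡x′ = +-cancelʳ-≡ y x x′ (trans sums (cong (x′ +_) (sym y≡y′)))

codeBool : Bool → ℕ
codeBool false = 0
codeBool true  = 1

codeBool-injective : ∀ {a b} → codeBool a ≡ codeBool b → a ≡ b
codeBool-injective {false} {false} _ = refl
codeBool-injective {true}  {true}  _ = refl

codeList : List ℕ → ℕ
codeList []       = 0
codeList (x ∷ xs) = suc (pair x (codeList xs))

codeList-injective : ∀ {xs ys} → codeList xs ≡ codeList ys → xs ≡ ys
codeList-injective {[]}     {[]}     _  = refl
codeList-injective {x ∷ xs} {y ∷ ys} eq =
  let eq₁ , eq₂ = pair-injective {x} {_} {y} (cong pred eq)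
  in cong₂ _∷_ eq₁ (codeList-injective eq₂)

codeVec : ∀ {A : Set} {n} → (A → ℕ) → Vec A n → ℕ
codeVec c []       = 0
codeVec c (x ∷ xs) = pair (c x) (codeVec c xs)

codeVec-injective : ∀ {A : Set} {n} {c : A → ℕ} →
                    (∀ {x y} → c x ≡ c y → x ≡ y) →
                    {xs ys : Vec A n} → codeVec c xs ≡ codeVec c ys → xs ≡ ys
codeVec-injective         inj {[]}     {[]}     _  = refl
codeVec-injective {c = c} inj {x ∷ xs} {y ∷ ys} eq =
  let eq₁ , eq₂ = pair-injective {c x} {_} {c y} eq
  in cong₂ _∷_ (inj eq₁) (codeVec-injective inj eq₂)

tag : Formula → ℕ
tag (pos _)    = 0
tag (neg _)    = 1
tag (_ ∨′ _)   = 2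
tag (_ ∧′ _)   = 3
tag (_ ∨ᴮ _)   = 4
tag (X∃ _)     = 5
tag [ _ U∃ _ ] = 6
tag [ _ W∃ _ ] = 7

codeFormula codeArguments : Formula → ℕ
codeFormula φ = pair (tag φ) (codeArguments φ)
codeArguments (pos p)    = p
codeArguments (neg p)    = p
codeArguments (φ ∨′ ψ)   = pair (codeFormula φ) (codeFormula ψ)
codeArguments (φ ∧′ ψ)   = pair (codeFormula φ) (codeFormula ψ)
codeArguments (φ ∨ᴮ ψ)   = pair (codeFormula φ) (codeFormula ψ)
codeArguments (X∃ φ)     = codeFormula φ
codeArguments [ φ U∃ ψ ] = pair (codeFormula φ) (codeFormula ψ)
codeArguments [ φ W∃ ψ ] = pair (codeFormula φ) (codeFormula ψ)

codeFormula-injective : ∀ φ ψ → codeFormula φ ≡ codeFormula ψ → φ ≡ ψ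

private
  arguments-injective : ∀ φ ψ → tag φ ≡ tag ψ →
                        codeArguments φ ≡ codeArguments ψ → φ ≡ ψ

  both-injective : ∀ φ φ′ ψ ψ′ →
    pair (codeFormula φ) (codeFormula φ′) ≡ pair (codeFormula ψ) (codeFormula ψ′) →
    φ ≡ ψ × φ′ ≡ ψ′

codeFormula-injective φ ψ eq =
  let eq₁ , eq₂ = pair-injective {tag φ} {codeArguments φ} {tag ψ} eq
  in arguments-injective φ ψ eq₁ eq₂

both-injective φ φ′ ψ ψ′ eq =
  let eq₁ , eq₂ = pair-injective {codeFormula φ} {codeFormula φ′} {codeFormula ψ} eq
  in codeFormula-injective φ ψ eq₁ , codeFormula-injective φ′ ψ′ eq₂

arguments-injective (pos p) (pos q) _ eq = cong pos eq
arguments-injective (neg p) (neg q) _ eq = cong neg eq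
arguments-injective (X∃ φ) (X∃ ψ) _ eq = cong X∃_ (codeFormula-injective φ ψ eq)
arguments-injective (φ ∨′ φ′) (ψ ∨′ ψ′) _ eq =
  let p , q = both-injective φ φ′ ψ ψ′ eq in cong₂ _∨′_ p q
arguments-injective (φ ∧′ φ′) (ψ ∧′ ψ′) _ eq =
  let p , q = both-injective φ φ′ ψ ψ′ eq in cong₂ _∧′_ p q
arguments-injective (φ ∨ᴮ φ′) (ψ ∨ᴮ ψ′) _ eq =
  let p , q = both-injective φ φ′ ψ ψ′ eq in cong₂ _∨ᴮ_ p q
arguments-injective [ φ U∃ φ′ ] [ ψ U∃ ψ′ ] _ eq =
  let p , q = both-injective φ φ′ ψ ψ′ eq in cong₂ [_U∃_] p q
arguments-injective [ φ W∃ φ′ ] [ ψ W∃ ψ′ ] _ eq =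
  let p , q = both-injective φ φ′ ψ ψ′ eq in cong₂ [_W∃_] p q

codeKripke : Kripke → ℕ
codeKripke K =
  pair size (pair (codeVec (codeVec codeBool) R) (pair (codeVec codeList η) (toℕ root)))
  where open Kripke K

codeKripke-injective : ∀ {K L} → codeKripke K ≡ codeKripke L → K ≡ L
codeKripke-injective {K} {L} eq with pair-injective {Kripke.size K} {_} {Kripke.size L} eq
... | refl , eq′ with pair-injective {codeVec (codeVec codeBool) (Kripke.R K)} eq′
... | eqR , eq″ with pair-injective {codeVec codeList (Kripke.η K)} eq″
... | eqη , eqr
  with codeVec-injective (codeVec-injective codeBool-injective) {Kripke.R K} {Kripke.R L} eqR
     | codeVec-injective codeList-injective {Kripke.η K} {Kripke.η L} eqη
     | toℕ-injective {i = Kripke.root K} {Kripke.root L} eqr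
... | refl | refl | refl = refl

encoding : Instance ↣ ℕ
encoding = mk↣ {to = code} code-injective
  where
  code : Instance → ℕ
  code (φ , K) = pair (codeFormula φ) (codeKripke K)

  code-injective : Injective _≡_ _≡_ code
  code-injective {φ , K} {ψ , L} eq =
    let eq₁ , eq₂ = pair-injective {codeFormula φ} {_} {codeFormula ψ} eq
    in cong₂ _,_ (codeFormula-injective φ ψ eq₁) (codeKripke-injective eq₂)

{-# OPTIONS --safe #-}

-- An arithmetical formula with set variables is evaluated by walkers on an infinite
-- word that carries the sets and a mark at every triangular number.  The place of a
-- walker is the value of a number variable, so number quantifiers say that a fresh
-- walker moves some or any number of steps.  As the marks are not ultimately
-- periodic, two walkers share a place iff they see the same marks forever when
-- moving on in lockstep.  Lockstep also yields addition, counting the steps between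
-- marks yields the triangular numbers, and both together yield multiplication.
--
-- In the team, walkers are traces, and the only split of the team selects those with
-- the guessed word.  A tef has to move some trace at every time; if the positions may
-- only have their current parities, or those with the parities of the walkers in S
-- flipped, then at every time exactly the walkers in S move.  Under this constraint
-- U and W quantify over the number of steps.
module Submission where

open import Defs
open import Level using (0ℓ)
open import Axiom.ExcludedMiddle using (ExcludedMiddle)
open import Axiom.Extensionality.Propositional using (Extensionality)
open import Data.Bool using (Bool; true; false; not; if_then_else_; _∨_) renaming (T to IsTrue)
import Data.Bool as Bool
import Data.Bool.Properties as Boolₚ
open import Data.Empty using (⊥-elim)
open import Data.Fin using (Fin; zero; suc; toℕ; combine; remQuot; finToFun; funToFin)
import Data.Fin as Fin
import Data.Fin.Properties as Finₚ
open import Data.Fin.Properties using (toℕ-injective; toℕ<n; remQuot-combine; finToFun-funToFin)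
open import Data.List using ([]; _∷_)
open import Data.List.Membership.Propositional using (_∈_)
open import Data.List.Relation.Unary.Any using (here)
open import Data.Nat hiding (parity)
open import Data.Nat.Properties
open import Data.Nat.Tactic.RingSolver using (solve-∀)
open import Data.Product using (Σ-syntax; ∃-syntax; _×_; _,_; proj₁; proj₂)
open import Data.Product.Function.NonDependent.Propositional using (_×-⇔_)
open import Data.Sum using (_⊎_; inj₁; inj₂; [_,_]′)
import Data.Sum as Sum
open import Data.Sum.Function.Propositional using (_⊎-⇔_)
open import Data.Unit using (tt)
open import Data.Vec using (Vec; []; _∷_; lookup; tabulate)
open import Data.Vec.Properties using (lookup∘tabulate)
open import Data.Vec.Relation.Binary.Pointwise.Inductive using ([]; _∷_)
open import Function using (_∘_; id)
open import Function.Bundles using (_⇔_; mk⇔; Equivalence; Injection)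
open import Relation.Binary.Definitions using (tri<; tri≈; tri>)
open import Relation.Binary.PropositionalEquality
open import Relation.Nullary using (¬_; Dec; yes; no)
open import Relation.Nullary.Decidable using (⌊_⌋; toWitness; fromWitness; decidable-stable; _×-dec_; _→-dec_)
open import Relation.Unary using (Pred; Decidable)

open Equivalence using (to; from)

-- Computability of codes

constant : ∀ {n} → ℕ → Rec n
constant zero    = zer
constant (suc c) = comp succ (constant c ∷ [])

⇓constant : ∀ {n} {xs : Vec ℕ n} c → constant c [ xs ]⇓ c
⇓constant zero    = ⇓zer
⇓constant (suc c) = ⇓comp (⇓constant c ∷ []) ⇓succ

addition : Rec 2
addition = prec (proj zero) (comp succ (proj (suc zero) ∷ []))

⇓addition : ∀ x y → addition [ x ∷ y ∷ [] ]⇓ x + y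
⇓addition zero    y = ⇓prec0 ⇓proj
⇓addition (suc x) y = ⇓precS (⇓addition x y) (⇓comp (⇓proj ∷ []) ⇓succ)

triangleRec : Rec 1
triangleRec = prec zer (comp succ (comp addition (proj zero ∷ proj (suc zero) ∷ []) ∷ []))

⇓triangle : ∀ n → triangleRec [ n ∷ [] ]⇓ triangle n
⇓triangle zero    = ⇓prec0 ⇓zer
⇓triangle (suc n) = ⇓precS (⇓triangle n)
  (⇓comp (⇓comp (⇓proj ∷ ⇓proj ∷ []) (⇓addition n (triangle n)) ∷ []) ⇓succ)

pairRec : Rec 2
pairRec = comp addition (comp triangleRec (addition ∷ []) ∷ proj (suc zero) ∷ [])

⇓pair : ∀ x y → pairRec [ x ∷ y ∷ [] ]⇓ pair x y
⇓pair x y = ⇓comp (⇓comp (⇓addition x y ∷ []) (⇓triangle (x + y)) ∷ ⇓proj ∷ []) (⇓addition (triangle (x + y)) y)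

constant-computable : ∀ c → Computable (λ _ → c)
constant-computable c = constant c , λ _ → ⇓constant c

pair-computable : ∀ {f g} → Computable f → Computable g → Computable (λ n → pair (f n) (g n))
pair-computable {f} {g} (d , ⇓f) (e , ⇓g) =
  comp pairRec (d ∷ e ∷ []) , λ n → ⇓comp (⇓f n ∷ ⇓g n ∷ []) (⇓pair (f n) (g n))

iterate-computable : ∀ {f h} → Computable h → (∀ n → f (suc n) ≡ h (f n)) → Computable f
iterate-computable {f} {h} (e , ⇓h) step = program , ⇓f
  where
  program : Rec 1
  program = prec (constant (f 0)) (comp e (proj (suc zero) ∷ []))
  ⇓f : ∀ n → program [ n ∷ [] ]⇓ f n
  ⇓f zero    = ⇓prec0 (⇓constant (f 0))
  ⇓f (suc n) = subst (program [ suc n ∷ [] ]⇓_) (sym (step n)) (⇓precS (⇓f n) (⇓comp (⇓proj ∷ []) (⇓h (f n))))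

-- Opaque, since conversion checking would otherwise evaluate codes of formulas.
abstract
  Computableᶠ : (ℕ → Formula) → Set
  Computableᶠ f = Computable (codeFormula ∘ f)

  ∧-computable : ∀ f g → Computableᶠ f → Computableᶠ g → Computableᶠ (λ n → f n ∧′ g n)
  ∧-computable f g F G = pair-computable (constant-computable 3) (pair-computable F G)

  ∨-computable : ∀ f g → Computableᶠ f → Computableᶠ g → Computableᶠ (λ n → f n ∨′ g n)
  ∨-computable f g F G = pair-computable (constant-computable 2) (pair-computable F G)

  X-computable : ∀ f → Computableᶠ f → Computableᶠ (λ n → X∃ f n)
  X-computable f F = pair-computable (constant-computable 5) F

  constant-computableᶠ : ∀ φ → Computableᶠ (λ _ → φ)
  constant-computableᶠ φ = constant-computable (codeFormula φ)

  X∧-iterate-computable : ∀ f θ → (∀ n → f (suc n) ≡ X∃ (θ ∧′ f n)) → Computableᶠ f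
  X∧-iterate-computable f θ step = iterate-computable
    -- 5 and 3 are the tags of `X∃_` and `_∧′_`, so one more step around a formula is a fixed
    -- function of its code.
    {h = λ c → pair 5 (pair 3 (pair (codeFormula θ) c))}
    (pair-computable (constant-computable 5) (pair-computable (constant-computable 3)
      (pair-computable (constant-computable (codeFormula θ)) (proj zero , λ n → ⇓proj))))
    (λ n → cong codeFormula (step n))

  instance-computable : ∀ f L → Computableᶠ f → Computable (λ n → Injection.to encoding (f n , L))
  instance-computable f L F = pair-computable F (constant-computable (codeKripke L))

-- Walkers and their translation to teams

infixr 6 _∧ʷ_
infixr 5 _∨ʷ_

-- Formulas about walkers, numbered by ℕ, that stand on one common infinite word
-- over Fin A.  The two numbers in a modality name the walkers that move, in
-- lockstep, while all others rest; "next x x" moves the single walker x.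
data Walk (A : ℕ) : Set where
  atom      : (Fin A → Bool) → Bool → ℕ → Walk A
  _∧ʷ_ _∨ʷ_ : Walk A → Walk A → Walk A
  next      : ℕ → ℕ → Walk A → Walk A
  until     : ℕ → ℕ → Walk A → Walk A → Walk A
  always    : ℕ → ℕ → Walk A → Walk A

among : ℕ → ℕ → ℕ → Bool
among x y z = (z ≡ᵇ x) ∨ (z ≡ᵇ y)

≡ᵇ-refl : ∀ n → (n ≡ᵇ n) ≡ true
≡ᵇ-refl zero    = refl
≡ᵇ-refl (suc n) = ≡ᵇ-refl n

move : (ℕ → Bool) → ℕ → (ℕ → ℕ) → ℕ → ℕ
move S k ps z = if S z then k + ps z else ps z

Sat : ∀ {A} → (ℕ → Fin A) → (ℕ → ℕ) → Walk A → Set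
Sat w ps (atom P b x)    = P (w (ps x)) ≡ b
Sat w ps (φ ∧ʷ ψ)        = Sat w ps φ × Sat w ps ψ
Sat w ps (φ ∨ʷ ψ)        = Sat w ps φ ⊎ Sat w ps ψ
Sat w ps (next x y φ)    = Sat w (move (among x y) 1 ps) φ
Sat w ps (until x y φ ψ) = ∃[ k ] Sat w (move (among x y) k ps) ψ ×
                            (∀ j → j < k → Sat w (move (among x y) j ps) φ)
Sat w ps (always x y φ)  = ∀ k → Sat w (move (among x y) k ps) φ

-- Bounding the first walker named in each modality is enough: it guarantees that
-- somebody moves.
width : ∀ {A} → Walk A → ℕ
width (atom P b x)    = suc x
width (φ ∧ʷ ψ)        = width φ ⊔ width ψ
width (φ ∨ʷ ψ)        = width φ ⊔ width ψ
width (next x y φ)    = suc x ⊔ width φ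
width (until x y φ ψ) = suc x ⊔ (width φ ⊔ width ψ)
width (always x y φ)  = suc x ⊔ width φ

-- The initial placement: walker 0, the level of the only free number variable, holds the input, and
-- every other walker is still fresh.
placed : ℕ → ℕ → ℕ
placed n zero    = n
placed n (suc _) = 0

flip : Fin 2 → Fin 2
flip zero       = suc zero
flip (suc zero) = zero

flip-involutive : ∀ p → flip (flip p) ≡ p
flip-involutive zero       = refl
flip-involutive (suc zero) = refl

flip-≢ : ∀ {p} → p ≢ flip p
flip-≢ {zero}     ()
flip-≢ {suc zero} ()

par : ℕ → Fin 2
par zero    = zero
par (suc n) = flip (par n)

-- Each walker has its own type of traces: the root, followed by states of that
-- type with alternating parities and arbitrary symbols.  A walker at place j is a
-- trace at position j + 1.
module Structure (N A : ℕ) (y₀ : Fin N) (a₀ : Fin A) where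

  Loc : Set
  Loc = Fin (N * (2 * A))

  size : ℕ
  size = suc (N * (2 * A))

  abstract
    loc : Fin N → Fin 2 → Fin A → Loc
    loc y p a = combine y (combine p a)

    type : Loc → Fin N
    type s = proj₁ (remQuot {N} (2 * A) s)

    parity : Loc → Fin 2
    parity s = proj₁ (remQuot {2} A (proj₂ (remQuot {N} (2 * A) s)))

    symbol : Loc → Fin A
    symbol s = proj₂ (remQuot {2} A (proj₂ (remQuot {N} (2 * A) s)))

    type-loc : ∀ y p a → type (loc y p a) ≡ y
    type-loc y p a = cong proj₁ (remQuot-combine y (combine p a))

    parity-loc : ∀ y p a → parity (loc y p a) ≡ p
    parity-loc y p a =
      trans (cong (proj₁ ∘ remQuot {2} A ∘ proj₂) (remQuot-combine y (combine p a)))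
            (cong proj₁ (remQuot-combine p a))

    symbol-loc : ∀ y p a → symbol (loc y p a) ≡ a
    symbol-loc y p a =
      trans (cong (proj₂ ∘ remQuot {2} A ∘ proj₂) (remQuot-combine y (combine p a)))
            (cong proj₂ (remQuot-combine p a))

  Follows : Loc → Loc → Set
  Follows s s′ = type s′ ≡ type s × parity s′ ≡ flip (parity s)

  follows? : ∀ s s′ → Dec (Follows s s′)
  follows? s s′ = (type s′ Fin.≟ type s) ×-dec (parity s′ Fin.≟ flip (parity s))

  -- All edges from the root enter parity `zero`, so on every path the parity at place `j` is
  -- `par j`; the parity of a state therefore reveals the parity of the position.
  edge : Fin size → Fin size → Bool
  edge _       zero     = false
  edge zero    (suc s)  = ⌊ parity s Fin.≟ zero ⌋
  edge (suc s) (suc s′) = ⌊ follows? s s′ ⌋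

  edge-total : ∀ v → ∃[ v′ ] IsTrue (edge v v′)
  edge-total zero    = suc (loc y₀ zero a₀) , fromWitness (parity-loc y₀ zero a₀)
  edge-total (suc s) = suc (loc (type s) (flip (parity s)) a₀) ,
    fromWitness (type-loc (type s) (flip (parity s)) a₀ , parity-loc (type s) (flip (parity s)) a₀)

  matrix : Vec (Vec Bool size) size
  matrix = tabulate (λ v → tabulate (edge v))

  matrix-edge : ∀ v v′ → lookup (lookup matrix v) v′ ≡ edge v v′
  matrix-edge v v′ = trans (cong (λ r → lookup r v′) (lookup∘tabulate (tabulate ∘ edge) v))
                           (lookup∘tabulate (edge v) v′)

  K : Kripke
  K = record
    { size  = size
    ; R     = matrix
    ; η     = tabulate (λ v → toℕ v ∷ [])
    ; root  = zero
    ; total = λ v → proj₁ (edge-total v) ,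
                    subst IsTrue (sym (matrix-edge v (proj₁ (edge-total v)))) (proj₂ (edge-total v))
    }

  module _ (π : Path K) where
    open Path π

    abstract
      nonroot : ∀ j → ∃[ s ] σ (suc j) ≡ suc s
      nonroot j with σ (suc j) in eq
      ... | suc s = s , refl
      ... | zero  = ⊥-elim (subst IsTrue (trans (matrix-edge (σ j) (σ (suc j)))
                                                (cong (edge (σ j)) eq)) (step j))

    after : ℕ → Loc
    after j = proj₁ (nonroot j)

    σ-after : ∀ j → σ (suc j) ≡ suc (after j)
    σ-after j = proj₂ (nonroot j)

    after-zero : parity (after 0) ≡ zero
    after-zero = toWitness (subst IsTrue (trans (matrix-edge (σ 0) (σ 1))
                                                (cong₂ edge start (σ-after 0))) (step 0))

    after-suc : ∀ j → Follows (after j) (after (suc j))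
    after-suc j = toWitness
      (subst IsTrue (trans (matrix-edge (σ (suc j)) (σ (suc (suc j))))
                           (cong₂ edge (σ-after j) (σ-after (suc j)))) (step (suc j)))

    walker : Fin N
    walker = type (after 0)

    word : ℕ → Fin A
    word j = symbol (after j)

    type-after : ∀ j → type (after j) ≡ walker
    type-after zero    = refl
    type-after (suc j) = trans (proj₁ (after-suc j)) (type-after j)

    parity-after : ∀ j → parity (after j) ≡ par j
    parity-after zero    = after-zero
    parity-after (suc j) = trans (proj₂ (after-suc j)) (cong flip (parity-after j))

    label : ∀ {i p} → trace (Traces K) π i p ⇔ p ≡ toℕ (σ i)
    label {i} = mk⇔
      (λ p∈ → only (subst (_ ∈_) (lookup∘tabulate (λ v → toℕ v ∷ []) (σ i)) p∈))
      (λ eq → subst (_ ∈_) (sym (lookup∘tabulate (λ v → toℕ v ∷ []) (σ i))) (here eq))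
      where
      only : ∀ {p q} → p ∈ q ∷ [] → p ≡ q
      only (here eq) = eq

  module _ (y : Fin N) (w : ℕ → Fin A) where

    private
      states : ℕ → Fin size
      states zero    = zero
      states (suc j) = suc (loc y (par j) (w j))

      states-step : ∀ j → IsTrue (edge (states j) (states (suc j)))
      states-step zero    = fromWitness (parity-loc y zero (w 0))
      states-step (suc j) = fromWitness
        ( trans (type-loc y (par (suc j)) (w (suc j))) (sym (type-loc y (par j) (w j)))
        , trans (parity-loc y (par (suc j)) (w (suc j))) (cong flip (sym (parity-loc y (par j) (w j)))))

    path : Path K
    path = record
      { σ     = states
      ; start = refl
      ; step  = λ j → subst IsTrue (sym (matrix-edge (states j) (states (suc j)))) (states-step j)
      }

    after-path : ∀ j → after path j ≡ loc y (par j) (w j)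
    after-path j = Finₚ.suc-injective (sym (σ-after path j))

    word-path : ∀ j → word path j ≡ w j
    word-path j = trans (cong symbol (after-path j)) (symbol-loc y (par j) (w j))

    walker-path : walker path ≡ y
    walker-path = trans (cong type (after-path 0)) (type-loc y zero (w 0))

  -- The proposition `size` labels no state. A positive literal does hold in the empty team, but
  -- that team has no tef, so `⊥ᶠ` is false wherever a tef is given.
  ⊤ᶠ ⊥ᶠ : Formula
  ⊤ᶠ = neg size
  ⊥ᶠ = pos size

  conj disj : ∀ {n} → (Fin n → Formula) → Formula
  conj {zero}  f = ⊤ᶠ
  conj {suc n} f = f zero ∧′ conj (f ∘ suc)
  disj {zero}  f = ⊥ᶠ
  disj {suc n} f = f zero ∨ᴮ disj (f ∘ suc)

  -- As each state is labelled by its own number, excluding the bad states one by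
  -- one expresses that all traces are in good states without splitting the team.
  unless : {P : Set} → Dec P → Formula → Formula
  unless (yes _) φ = ⊤ᶠ
  unless (no  _) φ = φ

  allIn : {P : Pred Loc 0ℓ} → Decidable P → Formula
  allIn P? = conj λ s → unless (P? s) (neg (toℕ (suc s)))

  ParityIs : (Fin N → Fin 2) → Loc → Set
  ParityIs c s = parity s ≡ c (type s)

  parityIs : (Fin N → Fin 2) → Formula
  parityIs c = allIn {ParityIs c} λ s → parity s Fin.≟ c (type s)

  flipOn : (ℕ → Bool) → (Fin N → Fin 2) → Fin N → Fin 2
  flipOn S c y = if S (toℕ y) then flip (c y) else c y

  lockstep : (ℕ → Bool) → (Fin N → Fin 2) → Formula
  lockstep S c = parityIs c ∨ᴮ parityIs (flipOn S c)

  -- Records the current parities in c, so that "lockstep" can refer to them later.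
  freeze : ((Fin N → Fin 2) → Formula) → Formula
  freeze f = disj {2 ^ N} λ e → parityIs (finToFun e) ∧′ f (finToFun e)

  AtomAt : (Fin A → Bool) → Bool → ℕ → Loc → Set
  AtomAt P b x s = toℕ (type s) ≡ x → P (symbol s) ≡ b

  -- The lockstep constraint stands in both arguments of `U∃`, so that it also covers the final
  -- time. `W∃ ⊥ᶠ` serves as "always", since `⊥ᶠ` holds at no time of a tef.
  translate : Walk A → Formula
  translate (atom P b x) = allIn {AtomAt P b x} λ s →
    (toℕ (type s) ≟ x) →-dec (P (symbol s) Bool.≟ b)
  translate (φ ∧ʷ ψ) = translate φ ∧′ translate ψ
  translate (φ ∨ʷ ψ) = translate φ ∨ᴮ translate ψ
  translate (next x y φ) = freeze λ c → X∃ (lockstep (among x y) c ∧′ translate φ)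
  translate (until x y φ ψ) = freeze λ c →
    [ (lockstep (among x y) c ∧′ translate φ) U∃ (lockstep (among x y) c ∧′ translate ψ) ]
  translate (always x y φ) = freeze λ c →
    [ (lockstep (among x y) c ∧′ translate φ) W∃ ⊥ᶠ ]

  -- Semantics of the translation in a selected subteam

  module Subteam (chosen : Path K → Bool) where

    𝒯 : Team
    𝒯 = Traces K ↾ chosen

    kind : Index 𝒯 → Fin N
    kind t = walker (proj₁ t)

    At : TimeEval 𝒯 → ℕ → (ℕ → ℕ) → Set
    At τ i ps = ∀ t → τ i t ≡ suc (ps (toℕ (kind t)))

    label-bound : ∀ t i → ¬ trace 𝒯 t i size
    label-bound t i p = <-irrefl (sym (to (label (proj₁ t)) p)) (toℕ<n (Path.σ (proj₁ t) i))

    ⊤ᶠ-holds : ∀ {τ i} → ⟨ 𝒯 , τ , i ⟩⊨ ⊤ᶠ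
    ⊤ᶠ-holds t = label-bound t _

    ⊥ᶠ-fails : ∀ {τ i} → IsTef 𝒯 τ → ¬ ⟨ 𝒯 , τ , i ⟩⊨ ⊥ᶠ
    ⊥ᶠ-fails (inc , _) h = proj₂ (inc 0) (λ t → ⊥-elim (label-bound t _ (h t)))

    conj-⇔ : ∀ {n τ i} {f : Fin n → Formula} →
             (⟨ 𝒯 , τ , i ⟩⊨ conj f) ⇔ (∀ j → ⟨ 𝒯 , τ , i ⟩⊨ f j)
    conj-⇔ = mk⇔ elim intro
      where
      elim : ∀ {n τ i} {f : Fin n → Formula} → ⟨ 𝒯 , τ , i ⟩⊨ conj f → ∀ j → ⟨ 𝒯 , τ , i ⟩⊨ f j
      elim (h , _)  zero    = h
      elim (_ , hs) (suc j) = elim hs j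
      intro : ∀ {n τ i} {f : Fin n → Formula} → (∀ j → ⟨ 𝒯 , τ , i ⟩⊨ f j) → ⟨ 𝒯 , τ , i ⟩⊨ conj f
      intro {zero}  {τ} {i} h = ⊤ᶠ-holds {τ} {i}
      intro {suc n} h = h zero , intro (h ∘ suc)

    disj-⇔ : ∀ {n τ i} {f : Fin n → Formula} → IsTef 𝒯 τ →
             (⟨ 𝒯 , τ , i ⟩⊨ disj f) ⇔ (∃[ j ] ⟨ 𝒯 , τ , i ⟩⊨ f j)
    disj-⇔ {τ = τ} {i} tef = mk⇔ elim (λ (j , h) → intro j h)
      where
      elim : ∀ {n} {f : Fin n → Formula} → ⟨ 𝒯 , τ , i ⟩⊨ disj f → ∃[ j ] ⟨ 𝒯 , τ , i ⟩⊨ f j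
      elim {zero}  h = ⊥-elim (⊥ᶠ-fails {i = i} tef h)
      elim {suc n} (inj₁ h) = zero , h
      elim {suc n} (inj₂ h) with elim h
      ... | j , h′ = suc j , h′
      intro : ∀ {n} {f : Fin n → Formula} → ∀ j → ⟨ 𝒯 , τ , i ⟩⊨ f j → ⟨ 𝒯 , τ , i ⟩⊨ disj f
      intro zero    h = inj₁ h
      intro (suc j) h = inj₂ (intro j h)

    module _ {P : Pred Loc 0ℓ} (P? : Decidable P) where

      allIn-elim : ∀ {τ i} → ⟨ 𝒯 , τ , i ⟩⊨ allIn P? →
                   ∀ t j → τ i t ≡ suc j → P (after (proj₁ t) j)
      allIn-elim {τ} {i} h t j eq with P? (after (proj₁ t) j) | to (conj-⇔ {i = i}) h (after (proj₁ t) j)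
      ... | yes p | _ = p
      ... | no ¬p | g = ⊥-elim (g t (from (label (proj₁ t))
        (cong toℕ (sym (trans (cong (Path.σ (proj₁ t)) eq) (σ-after (proj₁ t) j))))))

      allIn-intro : ∀ {τ i} → (∀ t → ∃[ j ] τ i t ≡ suc j × P (after (proj₁ t) j)) →
                    ⟨ 𝒯 , τ , i ⟩⊨ allIn P?
      allIn-intro {τ} {i} h = from (conj-⇔ {i = i}) good
        where
        good : ∀ s → ⟨ 𝒯 , τ , i ⟩⊨ unless (P? s) (neg (toℕ (suc s)))
        good s with P? s
        ... | yes _ = ⊤ᶠ-holds {τ} {i}
        ... | no ¬p = λ t l → let j , eq , p = h t in
          ¬p (subst P (Finₚ.suc-injective
            (trans (sym (σ-after (proj₁ t) j))
              (trans (cong (Path.σ (proj₁ t)) (sym eq)) (sym (toℕ-injective (to (label (proj₁ t)) l)))))) p)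

    parityIs-elim : ∀ {τ i c} → ⟨ 𝒯 , τ , i ⟩⊨ parityIs c → ∀ t j → τ i t ≡ suc j → par j ≡ c (kind t)
    parityIs-elim {τ} {i} {c} h t j eq =
      trans (sym (parity-after (proj₁ t) j))
        (trans (allIn-elim {ParityIs c} _ {τ} {i} h t j eq) (cong c (type-after (proj₁ t) j)))

    parityIs-intro : ∀ {τ i ps c} → At τ i ps → (∀ y → par (ps (toℕ y)) ≡ c y) →
                     ⟨ 𝒯 , τ , i ⟩⊨ parityIs c
    parityIs-intro {τ} {i} {ps} {c} at h = allIn-intro {ParityIs c} _ {τ} {i} λ t →
      ps (toℕ (kind t)) , at t ,
      trans (parity-after (proj₁ t) _) (trans (h (kind t)) (cong c (sym (type-after (proj₁ t) _))))

    module _ {τ : TimeEval 𝒯} (tef : IsTef 𝒯 τ) where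

      stay-or-go : ∀ m t → τ (suc m) t ≡ τ m t ⊎ τ (suc m) t ≡ suc (τ m t)
      stay-or-go m t with m≤n⇒m<n∨m≡n (proj₁ (proj₂ tef m) t)
      ... | inj₂ eq = inj₁ (sym eq)
      ... | inj₁ lt = inj₂ (≤-antisym (≤-trans (proj₂ (proj₂ tef m) t) (≤-reflexive (+-comm (τ m t) 1))) lt)

      -- A trace that advances changes its parity, so equal parity patterns at successive times mean
      -- that no trace moves, against the strictness of a tef.
      stuck : ∀ {m q c} → At τ m q → ⟨ 𝒯 , τ , m ⟩⊨ parityIs c → ¬ ⟨ 𝒯 , τ , suc m ⟩⊨ parityIs c
      stuck {m} {q} {c} at h h′ = proj₂ (proj₁ tef m) λ t → case t (stay-or-go m t)
        where
        case : ∀ t → _ → τ m t ≡ τ (suc m) t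
        case t (inj₁ eq) = sym eq
        case t (inj₂ eq) = ⊥-elim (flip-≢ (trans (parityIs-elim {τ} {m} {c} h t _ (at t))
          (sym (parityIs-elim {τ} {suc m} {c} h′ t _ (trans eq (cong suc (at t)))))))

      -- Each trace advances by 0 or 1, and its parity changes iff it advances; the two parity
      -- patterns thus tell exactly who moved.
      moved : ∀ {S m q d e} → At τ m q → (∀ y → e y ≡ flipOn S d y) →
              ⟨ 𝒯 , τ , m ⟩⊨ parityIs d → ⟨ 𝒯 , τ , suc m ⟩⊨ parityIs e → At τ (suc m) (move S 1 q)
      moved {S} {m} {q} {d} {e} at flips h h′ t with S (toℕ (kind t)) | flips (kind t) | stay-or-go m t
      ... | true  | _ | inj₂ eq = trans eq (cong suc (at t))
      ... | false | _ | inj₁ eq = trans eq (at t)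
      ... | true  | f | inj₁ eq = ⊥-elim (flip-≢ (trans (parityIs-elim {τ} {m} {d} h t _ (at t))
                (trans (trans (sym (flip-involutive _)) (cong flip (sym f)))
                  (cong flip (sym (parityIs-elim {τ} {suc m} {e} h′ t _ (trans eq (at t))))))))
      ... | false | f | inj₂ eq = ⊥-elim (flip-≢ (trans (parityIs-elim {τ} {m} {d} h t _ (at t))
                (sym (trans (parityIs-elim {τ} {suc m} {e} h′ t _ (trans eq (cong suc (at t)))) f))))

      lockstep-step : ∀ {S m q c} → At τ m q → ⟨ 𝒯 , τ , m ⟩⊨ lockstep S c →
                      ⟨ 𝒯 , τ , suc m ⟩⊨ lockstep S c → At τ (suc m) (move S 1 q)
      lockstep-step {S} {m} {q} {c} at (inj₁ h) (inj₁ h′) = ⊥-elim (stuck {m} {q} {c} at h h′)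
      lockstep-step {S} {m} {q} {c} at (inj₂ h) (inj₂ h′) = ⊥-elim (stuck {m} {q} {flipOn S c} at h h′)
      lockstep-step {S} {m} {q} {c} at (inj₁ h) (inj₂ h′) =
        moved {S} {m} {q} {c} {flipOn S c} at (λ _ → refl) h h′
      lockstep-step {S} {m} {q} {c} at (inj₂ h) (inj₁ h′) =
        moved {S} {m} {q} {flipOn S c} {c} at twice h h′
        where
        twice : ∀ y → c y ≡ flipOn S (flipOn S c) y
        twice y with S (toℕ y)
        ... | true  = sym (flip-involutive (c y))
        ... | false = refl

      lockstep-run : ∀ {S i ps c} → At τ i ps → ∀ k → (∀ j → j ≤ k → ⟨ 𝒯 , τ , j + i ⟩⊨ lockstep S c) →
                     At τ (k + i) (move S k ps)
      lockstep-run {S} at zero h t with S (toℕ (kind t))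
      ... | true  = at t
      ... | false = at t
      lockstep-run {S} {i} {ps} {c} at (suc k) h t =
        trans (lockstep-step {S} {k + i} {move S k ps} {c} (lockstep-run {S} {i} {ps} {c} at k (λ j j≤k → h j (m≤n⇒m≤1+n j≤k)))
                 (h k (n≤1+n k)) (h (suc k) ≤-refl) t)
              (cong suc merge)
        where
        merge : move S 1 (move S k ps) (toℕ (kind t)) ≡ move S (suc k) ps (toℕ (kind t))
        merge with S (toℕ (kind t))
        ... | true  = refl
        ... | false = refl

    -- The witness for the existential tefs: it keeps `τ` up to time `i`, where `j ∸ i` vanishes,
    -- and afterwards freezes `τ` at `i` while the walkers in `S` advance at every time.
    run : (ℕ → Bool) → TimeEval 𝒯 → ℕ → TimeEval 𝒯
    run S τ i j t = if S (toℕ (kind t)) then j ∸ i + τ (j ⊓ i) t else τ (j ⊓ i) t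

    run-past : ∀ S τ i j → j ≤ i → ∀ t → run S τ i j t ≡ τ j t
    run-past S τ i j j≤i t rewrite m≤n⇒m∸n≡0 j≤i | m≤n⇒m⊓n≡m j≤i with S (toℕ (kind t))
    ... | true  = refl
    ... | false = refl

    run-future : ∀ {S τ i ps} → At τ i ps → ∀ k → At (run S τ i) (k + i) (move S k ps)
    run-future {S} {τ} {i} {ps} at k t rewrite m+n∸n≡m k i | m≥n⇒m⊓n≡n (m≤n+m i k) with S (toℕ (kind t))
    ... | true  = trans (cong (k +_) (at t)) (+-suc k _)
    ... | false = at t

    Inhabited : Set
    Inhabited = ∀ y → ∃[ t ] kind t ≡ y

    -- After time `i` the trace moved by `S` provides strictness. The condition on `τ` concerns only
    -- earlier times, so that for `i = 0` any `τ` will do, as in `run-initial`.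
    run-step : ∀ S τ i → (∀ j → j < i → τ j <ᵗ τ (suc j) × τ (suc j) ≤ᵗ τ j +1ᵗ) →
               (∃[ t ] S (toℕ (kind t)) ≡ true) → IsTef 𝒯 (run S τ i)
    run-step S τ i past (t₀ , St₀) = (λ j → proj₁ (both j)) , λ j → proj₁ (proj₁ (both j)) , proj₂ (both j)
      where
      both : ∀ j → run S τ i j <ᵗ run S τ i (suc j) × run S τ i (suc j) ≤ᵗ run S τ i j +1ᵗ
      both j with <-≤-connex j i
      ... | inj₁ j<i =
        ( (λ t → subst₂ _≤_ (sym (run-past S τ i j (<⇒≤ j<i) t)) (sym (run-past S τ i (suc j) j<i t)) (proj₁ lt t))
        , (λ eq → proj₂ lt λ t → trans (sym (run-past S τ i j (<⇒≤ j<i) t)) (trans (eq t) (run-past S τ i (suc j) j<i t))))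
        , λ t → subst₂ _≤_ (sym (run-past S τ i (suc j) j<i t)) (cong (_+ 1) (sym (run-past S τ i j (<⇒≤ j<i) t))) (le t)
        where
        lt = proj₁ (past j j<i)
        le = proj₂ (past j j<i)
      ... | inj₂ i≤j = (up , λ eq → diff (eq t₀)) , bound
        where
        up : run S τ i j ≤ᵗ run S τ i (suc j)
        up t rewrite m≥n⇒m⊓n≡n i≤j | m≥n⇒m⊓n≡n (m≤n⇒m≤1+n i≤j) | +-∸-assoc 1 i≤j with S (toℕ (kind t))
        ... | true  = n≤1+n _
        ... | false = ≤-refl
        bound : run S τ i (suc j) ≤ᵗ run S τ i j +1ᵗ
        bound t rewrite m≥n⇒m⊓n≡n i≤j | m≥n⇒m⊓n≡n (m≤n⇒m≤1+n i≤j) | +-∸-assoc 1 i≤j with S (toℕ (kind t))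
        ... | true  = ≤-reflexive (+-comm 1 _)
        ... | false = m≤m+n _ 1
        diff : run S τ i j t₀ ≢ run S τ i (suc j) t₀
        diff eq rewrite m≥n⇒m⊓n≡n i≤j | m≥n⇒m⊓n≡n (m≤n⇒m≤1+n i≤j) | +-∸-assoc 1 i≤j | St₀ = <⇒≢ (n<1+n _) eq

    run-tef : ∀ {S τ i} → IsTef 𝒯 τ → (∃[ t ] S (toℕ (kind t)) ≡ true) → IsTef 𝒯 (run S τ i)
    run-tef {S} {τ} {i} (inc , stut) = run-step S τ i (λ j _ → inc j , proj₂ (stut j))

    run-initial : ∀ {S τ} → (∃[ t ] S (toℕ (kind t)) ≡ true) → IsTef 𝒯 (run S τ 0)
    run-initial {S} {τ} = run-step S τ 0 λ j ()

    Phase : (ℕ → Bool) → (Fin N → Fin 2) → (ℕ → ℕ) → Set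
    Phase S c ps = (∀ y → par (ps (toℕ y)) ≡ c y) ⊎ (∀ y → par (ps (toℕ y)) ≡ flipOn S c y)

    -- Each further step of the walkers in `S` toggles between the two parity patterns, because
    -- `flip` is an involution.
    phase-move : ∀ {S c ps} → Phase S c ps → ∀ k → Phase S c (move S k ps)
    phase-move {S} {c} {ps} ph zero = Sum.map (λ h y → trans (cong par (still y)) (h y))
                                              (λ h y → trans (cong par (still y)) (h y)) ph
      where
      still : ∀ y → move S 0 ps (toℕ y) ≡ ps (toℕ y)
      still y with S (toℕ y)
      ... | true  = refl
      ... | false = refl
    phase-move {S} {c} {ps} ph (suc k) = [ inj₂ ∘ forth , inj₁ ∘ back ]′ (phase-move {S} {c} {ps} ph k)
      where
      forth : (∀ y → par (move S k ps (toℕ y)) ≡ c y) → ∀ y → par (move S (suc k) ps (toℕ y)) ≡ flipOn S c y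
      forth h y with S (toℕ y) | h y
      ... | true  | eq = cong flip eq
      ... | false | eq = eq
      back : (∀ y → par (move S k ps (toℕ y)) ≡ flipOn S c y) → ∀ y → par (move S (suc k) ps (toℕ y)) ≡ c y
      back h y with S (toℕ y) | h y
      ... | true  | eq = trans (cong flip eq) (flip-involutive (c y))
      ... | false | eq = eq

    lockstep-intro : ∀ {S c τ i ps} → At τ i ps → Phase S c ps → ⟨ 𝒯 , τ , i ⟩⊨ lockstep S c
    lockstep-intro {S} {c} {τ} {i} {ps} at =
      Sum.map (parityIs-intro {τ} {i} {ps} {c} at) (parityIs-intro {τ} {i} {ps} {flipOn S c} at)

    at-transport : ∀ {τ τ′ i ps} → (∀ j → j ≤ i → ∀ t → τ′ j t ≡ τ j t) → At τ i ps → At τ′ i ps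
    at-transport {i = i} agree at t = trans (agree i ≤-refl t) (at t)

    Represents : Formula → ((ℕ → ℕ) → Set) → Set
    Represents ψ P = ∀ {τ i ps} → IsTef 𝒯 τ → At τ i ps → (⟨ 𝒯 , τ , i ⟩⊨ ψ) ⇔ P ps

    module _ {S : ℕ → Bool} {c : Fin N → Fin 2} {τ : TimeEval 𝒯} {i : ℕ} {ps : ℕ → ℕ}
             (some : ∃[ t ] S (toℕ (kind t)) ≡ true)
             (tef : IsTef 𝒯 τ) (at : At τ i ps) (phase : Phase S c ps) where

      private
        running : IsTef 𝒯 (run S τ i)
        running = run-tef {S} {τ} {i} tef some

        at-run : ∀ k → At (run S τ i) (k + i) (move S k ps)
        at-run = run-future {S} {τ} {i} {ps} at

        lockstep-at-run : ∀ k → ⟨ 𝒯 , run S τ i , k + i ⟩⊨ lockstep S c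
        lockstep-at-run k =
          lockstep-intro {S} {c} {run S τ i} {k + i} {move S k ps} (at-run k) (phase-move {S} {c} {ps} phase k)

        at-lockstep : ∀ {τ′} → IsTef 𝒯 τ′ → (∀ j → j ≤ i → ∀ t → τ′ j t ≡ τ j t) → ∀ k →
                      (∀ j → j ≤ k → ⟨ 𝒯 , τ′ , j + i ⟩⊨ lockstep S c) → At τ′ (k + i) (move S k ps)
        at-lockstep {τ′} tef′ agree =
          lockstep-run tef′ {S} {i} {ps} {c} (at-transport {τ} {τ′} {i} {ps} agree at)

      -- The hypothesis speaks of one time and one placement only, instead of `Represents`, because
      -- `advance` is analysed just for the placements `placed j`.
      next-⇔ : ∀ {ψ} {Q : Set} →
               (∀ {τ′} → IsTef 𝒯 τ′ → At τ′ (suc i) (move S 1 ps) → (⟨ 𝒯 , τ′ , suc i ⟩⊨ ψ) ⇔ Q) →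
               (⟨ 𝒯 , τ , i ⟩⊨ X∃ (lockstep S c ∧′ ψ)) ⇔ Q
      next-⇔ rep = mk⇔
        (λ (τ′ , tef′ , agree , h , hψ) → to (rep tef′ (at-lockstep tef′ agree 1 λ
          -- The formula imposes the constraint from time `suc i` on; at time `i` it follows from
          -- the phase.
          { zero _ → lockstep-intro {S} {c} {τ′} {i} {ps} (at-transport {τ} {τ′} {i} {ps} agree at) phase
          ; (suc zero) _ → h
          ; (suc (suc _)) (s≤s ()) })) hψ)
        (λ p → run S τ i , running , run-past S τ i ,
               lockstep-at-run 1 , from (rep running (at-run 1)) p)

      until-⇔ : ∀ {ψ χ P Q} → Represents ψ P → Represents χ Q →
                (⟨ 𝒯 , τ , i ⟩⊨ [ (lockstep S c ∧′ ψ) U∃ (lockstep S c ∧′ χ) ]) ⇔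
                (∃[ k ] Q (move S k ps) × (∀ j → j < k → P (move S j ps)))
      until-⇔ {ψ} {χ} {P} {Q} rep rep′ = mk⇔ sound complete
        where
        sound : (⟨ 𝒯 , τ , i ⟩⊨ [ (lockstep S c ∧′ ψ) U∃ (lockstep S c ∧′ χ) ]) →
                ∃[ k ] Q (move S k ps) × (∀ j → j < k → P (move S j ps))
        -- Write the time `k` as `d + i`, where `d` is the number of steps of the run.
        sound (τ′ , tef′ , agree , k , i≤k , (h , hχ) , before) with k ∸ i | m∸n+n≡m i≤k
        ... | d | refl = d , to (rep′ tef′ (at-j d ≤-refl)) hχ ,
                         λ j j<d → to (rep tef′ (at-j j (<⇒≤ j<d))) (proj₂ (before (j + i) (m≤n+m i j) (+-monoˡ-< i j<d)))
          where
          locked : ∀ j → j ≤ d → ⟨ 𝒯 , τ′ , j + i ⟩⊨ lockstep S c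
          -- Before the last time the constraint comes from the left argument of `U∃`, at the last
          -- time from the right one.
          locked j j≤d with m≤n⇒m<n∨m≡n j≤d
          ... | inj₁ j<d  = proj₁ (before (j + i) (m≤n+m i j) (+-monoˡ-< i j<d))
          ... | inj₂ refl = h
          at-j : ∀ j → j ≤ d → At τ′ (j + i) (move S j ps)
          at-j j j≤d = at-lockstep tef′ agree j (λ l l≤j → locked l (≤-trans l≤j j≤d))
        complete : (∃[ k ] Q (move S k ps) × (∀ j → j < k → P (move S j ps))) →
                   ⟨ 𝒯 , τ , i ⟩⊨ [ (lockstep S c ∧′ ψ) U∃ (lockstep S c ∧′ χ) ]
        complete (k , q , p) = run S τ i , running , run-past S τ i , k + i , m≤n+m i k ,
          (lockstep-at-run k , from (rep′ running (at-run k)) q) , before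
          where
          before : ∀ m → i ≤ m → m < k + i → ⟨ 𝒯 , run S τ i , m ⟩⊨ (lockstep S c ∧′ ψ)
          before m i≤m m<k with m ∸ i | m∸n+n≡m i≤m
          ... | j | refl = lockstep-at-run j ,
                           from (rep running (at-run j)) (p j (+-cancelʳ-< i j k m<k))

      always-⇔ : ∀ {ψ P} → Represents ψ P →
                 (⟨ 𝒯 , τ , i ⟩⊨ [ (lockstep S c ∧′ ψ) W∃ ⊥ᶠ ]) ⇔ (∀ k → P (move S k ps))
      always-⇔ {ψ} {P} rep = mk⇔ sound complete
        where
        sound : (⟨ 𝒯 , τ , i ⟩⊨ [ (lockstep S c ∧′ ψ) W∃ ⊥ᶠ ]) → ∀ k → P (move S k ps)
        sound (τ′ , tef′ , agree , h) k =
          to (rep tef′ (at-lockstep tef′ agree k λ j _ → proj₁ (here′ j))) (proj₂ (here′ k))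
          where
          here′ : ∀ j → ⟨ 𝒯 , τ′ , j + i ⟩⊨ (lockstep S c ∧′ ψ)
          here′ j with h (j + i) (m≤n+m i j)
          ... | inj₁ h′ = h′
          ... | inj₂ (m , _ , _ , h′) = ⊥-elim (⊥ᶠ-fails {i = m} tef′ h′)
        complete : (∀ k → P (move S k ps)) → ⟨ 𝒯 , τ , i ⟩⊨ [ (lockstep S c ∧′ ψ) W∃ ⊥ᶠ ]
        complete p = run S τ i , running , run-past S τ i , λ m i≤m → inj₁ (at-m m i≤m)
          where
          at-m : ∀ m → i ≤ m → ⟨ 𝒯 , run S τ i , m ⟩⊨ (lockstep S c ∧′ ψ)
          at-m m i≤m with m ∸ i | m∸n+n≡m i≤m
          ... | j | refl = lockstep-at-run j , from (rep running (at-run j)) (p j)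

    module Faithful (w : ℕ → Fin A) (words : ∀ (t : Index 𝒯) j → word (proj₁ t) j ≡ w j) (inhabited : Inhabited) where

      -- Every type has a trace, so the disjunct that holds must have guessed the true parity of
      -- each walker; a type without traces would leave its parity open.
      freeze-⇔ : ∀ {τ i ps} {Q : Set} f → IsTef 𝒯 τ → At τ i ps →
                 (∀ c → (∀ y → par (ps (toℕ y)) ≡ c y) → (⟨ 𝒯 , τ , i ⟩⊨ f c) ⇔ Q) →
                 (⟨ 𝒯 , τ , i ⟩⊨ freeze f) ⇔ Q
      freeze-⇔ {τ} {i} {ps} {Q} f tef at equiv = mk⇔ sound complete
        where
        sound : ⟨ 𝒯 , τ , i ⟩⊨ freeze f → Q
        sound h with to (disj-⇔ {2 ^ N} {i = i} tef) h
        ... | e , hc , hf = to (equiv (finToFun e) parities) hf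
          where
          parities : ∀ y → par (ps (toℕ y)) ≡ finToFun e y
          parities y with inhabited y
          ... | t , refl = parityIs-elim {τ} {i} {finToFun e} hc t _ (at t)
        complete : Q → ⟨ 𝒯 , τ , i ⟩⊨ freeze f
        complete q = from (disj-⇔ {2 ^ N} {i = i} tef) (e , parityIs-intro {τ} {i} {ps} {finToFun e} at parities ,
                                                   from (equiv (finToFun e) parities) q)
          where
          e : Fin (2 ^ N)
          e = funToFin {N} (λ y → par (ps (toℕ y)))
          parities : ∀ y → par (ps (toℕ y)) ≡ finToFun e y
          parities y = sym (finToFun-funToFin (λ y → par (ps (toℕ y))) y)

      exists : ∀ x → x < N → ∃[ t ] toℕ (kind t) ≡ x
      exists x x<N with inhabited (Fin.fromℕ< x<N)
      ... | t , eq = t , trans (cong toℕ eq) (Finₚ.toℕ-fromℕ< x<N)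

      someone-moves : ∀ {x} y → x < N → ∃[ t ] among x y (toℕ (kind t)) ≡ true
      someone-moves {x} y x<N with exists x x<N
      ... | t , refl = t , cong (_∨ (toℕ (kind t) ≡ᵇ y)) (≡ᵇ-refl (toℕ (kind t)))

      faithful : ∀ φ → width φ ≤ N → Represents (translate φ) (λ ps → Sat w ps φ)
      faithful (atom P b x) x<N {τ} {i} {ps} tef at = mk⇔ sound complete
        where
        sound : ⟨ 𝒯 , τ , i ⟩⊨ translate (atom P b x) → P (w (ps x)) ≡ b
        sound h with exists x x<N
        ... | t , refl = trans (cong P (sym (words t _)))
          (allIn-elim {AtomAt P b x} _ {τ} {i} h t _ (at t) (cong toℕ (type-after (proj₁ t) _)))
        complete : P (w (ps x)) ≡ b → ⟨ 𝒯 , τ , i ⟩⊨ translate (atom P b x)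
        complete p = allIn-intro {AtomAt P b x} _ {τ} {i} λ t → ps (toℕ (kind t)) , at t , λ eq →
          trans (cong P (words t _))
            (trans (cong (P ∘ w ∘ ps) (trans (cong toℕ (sym (type-after (proj₁ t) (ps (toℕ (kind t)))))) eq)) p)
      faithful (φ ∧ʷ ψ) wd tef at =
        mk⇔ (λ (h , h′) → to rep h , to rep′ h′) (λ (s , s′) → from rep s , from rep′ s′)
        where
        rep  = faithful φ (m⊔n≤o⇒m≤o (width φ) (width ψ) wd) tef at
        rep′ = faithful ψ (m⊔n≤o⇒n≤o (width φ) (width ψ) wd) tef at
      faithful (φ ∨ʷ ψ) wd tef at = mk⇔ (Sum.map (to rep) (to rep′)) (Sum.map (from rep) (from rep′))
        where
        rep  = faithful φ (m⊔n≤o⇒m≤o (width φ) (width ψ) wd) tef at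
        rep′ = faithful ψ (m⊔n≤o⇒n≤o (width φ) (width ψ) wd) tef at
      faithful (next x y φ) wd {τ} {i} {ps} tef at = freeze-⇔ {τ} {i} {ps}
        (λ c → X∃ (lockstep (among x y) c ∧′ translate φ)) tef at λ c pc →
        next-⇔ {among x y} {c} {ps = ps} (someone-moves y (m⊔n≤o⇒m≤o (suc x) (width φ) wd)) tef at (inj₁ pc)
          (faithful φ (m⊔n≤o⇒n≤o (suc x) (width φ) wd))
      faithful (until x y φ ψ) wd {τ} {i} {ps} tef at = freeze-⇔ {τ} {i} {ps}
        (λ c → [ (lockstep (among x y) c ∧′ translate φ) U∃ (lockstep (among x y) c ∧′ translate ψ) ]) tef at λ c pc →
        until-⇔ {among x y} {c} (someone-moves y (m⊔n≤o⇒m≤o (suc x) (width φ ⊔ width ψ) wd)) tef at (inj₁ pc)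
          {P = λ ps → Sat w ps φ} {Q = λ ps → Sat w ps ψ}
          (faithful φ (m⊔n≤o⇒m≤o (width φ) (width ψ) wd′)) (faithful ψ (m⊔n≤o⇒n≤o (width φ) (width ψ) wd′))
        where
        wd′ = m⊔n≤o⇒n≤o (suc x) (width φ ⊔ width ψ) wd
      faithful (always x y φ) wd {τ} {i} {ps} tef at = freeze-⇔ {τ} {i} {ps}
        (λ c → [ (lockstep (among x y) c ∧′ translate φ) W∃ ⊥ᶠ ]) tef at λ c pc →
        always-⇔ {among x y} {c} (someone-moves y (m⊔n≤o⇒m≤o (suc x) (width φ) wd)) tef at (inj₁ pc)
          {P = λ ps → Sat w ps φ} (faithful φ (m⊔n≤o⇒n≤o (suc x) (width φ) wd))

  -- The sentence for an input number

  zeros : Fin N → Fin 2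
  zeros _ = zero

  everyone : ℕ → Bool
  everyone _ = true

  module Reduction (φ : Walk A) where

    -- Brings the input to walker 0 by `n` single steps. The parity patterns refer to `zeros`
    -- throughout instead of being frozen anew, so each step puts the previous formula once into a
    -- fixed context, as `X∧-iterate-computable` demands.
    advance : ℕ → Formula
    advance zero    = translate φ
    advance (suc n) = X∃ (lockstep (among 0 0) zeros ∧′ advance n)

    sameSymbol : Formula
    sameSymbol = disj λ a → allIn {λ s → symbol s ≡ a} λ s → symbol s Fin.≟ a

    -- `commonWord` compares the symbols while all walkers advance together from place 0.
    -- `everyKind` says that each type has a trace: if only walker `toℕ y` may move, then strictness
    -- needs some trace of type `y`.
    commonWord everyKind : Formula
    commonWord = [ (lockstep everyone zeros ∧′ sameSymbol) W∃ ⊥ᶠ ]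
    everyKind  = conj {N} λ y → X∃ (lockstep (among (toℕ y) (toℕ y)) zeros ∧′ ⊤ᶠ)

    -- To be read at time 1. The proposition 0 labels just the root, so `neg 0` forces every
    -- selected trace to leave the root in the first step, which puts all walkers at place 0.
    setup : ℕ → Formula
    setup n = neg 0 ∧′ (commonWord ∧′ (everyKind ∧′ advance n))

    -- The split guesses which traces to keep, and the others satisfy `⊤ᶠ`. Restricted to the kept
    -- traces, the initial tef may stutter; `X∃_` replaces it by a tef of the subteam.
    sentence : ℕ → Formula
    sentence n = (X∃ setup n) ∨′ ⊤ᶠ

    sentence-computable : Computableᶠ sentence
    sentence-computable =
      ∨-computable (λ n → X∃ setup n) (λ _ → ⊤ᶠ)
        (X-computable setup (∧-computable (λ _ → neg 0) (λ n → commonWord ∧′ (everyKind ∧′ advance n))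
          (constant-computableᶠ (neg 0)) (∧-computable (λ _ → commonWord) (λ n → everyKind ∧′ advance n)
            (constant-computableᶠ commonWord) (∧-computable (λ _ → everyKind) advance
              (constant-computableᶠ everyKind)
              (X∧-iterate-computable advance (lockstep (among 0 0) zeros) (λ _ → refl))))))
        (constant-computableᶠ ⊤ᶠ)

    module _ (em : ExcludedMiddle 0ℓ) (wide : width φ ≤ N) where

      module _ (chosen : Path K → Bool) where
        open Subteam chosen

        inhabited-sound : ∀ {τ i} → IsTef 𝒯 τ → At τ i (λ _ → 0) → ⟨ 𝒯 , τ , i ⟩⊨ everyKind → Inhabited
        inhabited-sound {τ} {i} tef at h y with em {P = ∃[ t ] kind t ≡ y}
        ... | yes p = p
        ... | no ¬p = let τ′ , tef′ , agree , locked , _ = to (conj-⇔ {N} {i = i}) h y in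
                      ⊥-elim (refute tef′ agree locked)
          where
          refute : ∀ {τ′} → IsTef 𝒯 τ′ → (∀ j → j ≤ i → ∀ t → τ′ j t ≡ τ j t) →
                   ¬ ⟨ 𝒯 , τ′ , suc i ⟩⊨ lockstep (among (toℕ y) (toℕ y)) zeros
          refute {τ′} tef′ agree locked =
            proj₂ (proj₁ tef′ i) λ t → trans (at′ t) (sym (trans (at″ t) (cong suc (still t))))
            where
            S = among (toℕ y) (toℕ y)
            at′ : At τ′ i (λ _ → 0)
            at′ = at-transport {τ} {τ′} {i} {λ _ → 0} agree at
            at″ : At τ′ (suc i) (move S 1 (λ _ → 0))
            at″ = lockstep-step tef′ {S} {i} {λ _ → 0} {zeros} at′
                    (lockstep-intro {S} {zeros} {τ′} {i} {λ _ → 0} at′ (inj₁ λ _ → refl)) locked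
            still : ∀ t → move S 1 (λ _ → 0) (toℕ (kind t)) ≡ 0
            still t with toℕ (kind t) ≡ᵇ toℕ y in eq
            ... | true  = ⊥-elim (¬p (t , toℕ-injective (≡ᵇ⇒≡ _ _ (subst IsTrue (sym eq) tt))))
            ... | false = refl

        sameSymbol-⇔ : Represents sameSymbol (λ ps → ∃[ a ] ∀ t → word (proj₁ t) (ps (toℕ (kind t))) ≡ a)
        sameSymbol-⇔ {τ} {i} tef at = mk⇔
          (λ h → let a , h′ = to (disj-⇔ {A} {i = i} tef) h in
                 a , λ t → allIn-elim {λ s → symbol s ≡ a} _ {τ} {i} h′ t _ (at t))
          (λ (a , h) → from (disj-⇔ {A} {i = i} tef)
                         (a , allIn-intro {λ s → symbol s ≡ a} _ {τ} {i} λ t → _ , at t , h t))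

        commonWord-⇔ : ∀ {τ i} → IsTef 𝒯 τ → At τ i (λ _ → 0) → Inhabited →
                       (⟨ 𝒯 , τ , i ⟩⊨ commonWord) ⇔ (∀ k → ∃[ a ] ∀ t → word (proj₁ t) (k + 0) ≡ a)
        commonWord-⇔ tef at inhabited =
          always-⇔ {everyone} {zeros} {ps = λ _ → 0} (proj₁ (inhabited y₀) , refl) tef at (inj₁ λ _ → refl)
            {P = λ ps → ∃[ a ] ∀ t → word (proj₁ t) (ps (toℕ (kind t))) ≡ a} (λ {τ} {i} {ps} → sameSymbol-⇔ {τ} {i} {ps})

        module _ (w : ℕ → Fin A) (words : ∀ (t : Index 𝒯) j → word (proj₁ t) j ≡ w j) (inhabited : Inhabited) where
          open Faithful w words inhabited

          -- The induction carries the place `j` that walker 0 has reached. Having come from place 0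
          -- in `j` steps, it is in one of the two phases of `zeros`.
          advance-⇔ : ∀ n j {τ i} → IsTef 𝒯 τ → At τ i (placed j) →
                      (⟨ 𝒯 , τ , i ⟩⊨ advance n) ⇔ Sat w (placed (j + n)) φ
          advance-⇔ zero    j tef at rewrite +-identityʳ j = faithful φ wide tef at
          advance-⇔ (suc n) j {τ} {i} tef at rewrite +-suc j n =
            next-⇔ {among 0 0} {zeros} {ps = placed j}
              (someone-moves 0 (≤-trans (s≤s z≤n) (toℕ<n y₀))) tef at (phase j)
              (λ {τ′} tef′ at′ → advance-⇔ n (suc j) tef′ λ t → trans (at′ t) (cong suc (moved-placed (toℕ (kind t)))))
            where
            moved-placed : ∀ z → move (among 0 0) 1 (placed j) z ≡ placed (suc j) z
            moved-placed zero    = refl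
            moved-placed (suc _) = refl
            phase : ∀ j → Phase (among 0 0) zeros (placed j)
            phase j with phase-move {among 0 0} {zeros} {placed 0} (inj₁ λ { zero → refl ; (suc _) → refl }) j
            ... | p = Sum.map (λ h y → trans (cong par (sym (at-j (toℕ y)))) (h y))
                              (λ h y → trans (cong par (sym (at-j (toℕ y)))) (h y)) p
              where
              at-j : ∀ z → move (among 0 0) j (placed 0) z ≡ placed j z
              at-j zero    = +-identityʳ j
              at-j (suc _) = refl

      sound : ∀ n → Traces K ⊨∃ sentence n → ∃[ w ] Sat w (placed n) φ
      sound n (τ , _ , initial , chosen , (τ′ , tef′ , agree , h₀ , hw , hk , hn) , _) =
        w , to (advance-⇔ chosen w words inhabited n 0 tef′ (λ t → trans (at t) (cong suc (placed-zero _)))) hn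
        where
        open Subteam chosen
        at : At τ′ 1 (λ _ → 0)
        at t with stay-or-go tef′ 0 t | trans (agree 0 z≤n t) (initial (proj₁ t))
        ... | inj₂ eq | z = trans eq (cong suc z)
        -- A trace that rests in the first step is still at the root, which `neg 0` excludes.
        ... | inj₁ eq | z = ⊥-elim (h₀ t (from (label (proj₁ t))
                              (sym (cong toℕ (trans (cong (Path.σ (proj₁ t)) (trans eq z)) (Path.start (proj₁ t)))))))
        inhabited : Inhabited
        inhabited = inhabited-sound chosen tef′ at hk
        t₀ : Index 𝒯
        t₀ = proj₁ (inhabited y₀)
        w : ℕ → Fin A
        w = word (proj₁ t₀)
        words : ∀ t j → word (proj₁ t) j ≡ w j
        words t j =
          let _ , h = to (commonWord-⇔ chosen tef′ at inhabited) hw j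
              j≡j+0 = sym (+-identityʳ j)
          in trans (cong (word (proj₁ t)) j≡j+0)
               (trans (h t) (trans (sym (h t₀)) (cong w (+-identityʳ j))))
        placed-zero : ∀ z → 0 ≡ placed 0 z
        placed-zero zero    = refl
        placed-zero (suc _) = refl

      complete : ∀ n → (∃[ w ] Sat w (placed n) φ) → Traces K ⊨∃ sentence n
      -- The outer tef advances all traces at every time; `path y₀ w` shows that there is a trace,
      -- as strictness requires.
      complete n (w , s) = (λ i _ → i) ,
        ( (λ i → (λ _ → n≤1+n i) , λ eq → <⇒≢ (n<1+n i) (eq (path y₀ w)))
        , (λ i → (λ _ → n≤1+n i) , λ _ → ≤-reflexive (+-comm 1 i))) ,
        (λ _ → refl) , chosen ,
        ( τ , tef , run-past everyone _ 0 , (λ t p → nonzero t (to (label (proj₁ t)) p))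
        , from (commonWord-⇔ chosen tef at inhabited) (λ k → w (k + 0) , λ t → words t (k + 0))
        , from (conj-⇔ {N} {i = 1}) (λ y → from (next-⇔ {among (toℕ y) (toℕ y)} {zeros} {ps = λ _ → 0}
            (someone-moves {toℕ y} (toℕ y) (toℕ<n y)) tef at (inj₁ λ _ → refl)
            {⊤ᶠ} (λ {τ″} _ _ → mk⇔ (λ _ → tt) (λ _ → ⊤ᶠ-holds {τ″} {2}))) tt)
        , from (advance-⇔ chosen w words inhabited n 0 tef (λ t → trans (at t) (cong suc (placed-zero _)))) s) ,
        λ t → Subteam.label-bound (not ∘ chosen) t _
        where
        chosen : Path K → Bool
        -- Excluded middle turns "carries the word `w`" into a Boolean selection; the subteam
        -- contains a path of every type.
        chosen π = ⌊ em {P = ∀ j → word π j ≡ w j} ⌋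
        open Subteam chosen
        words : ∀ t j → word (proj₁ t) j ≡ w j
        words (π , c) = toWitness c
        inhabited : Inhabited
        inhabited y = (path y w , fromWitness (word-path y w)) , walker-path y w
        open Faithful w words inhabited
        τ : TimeEval 𝒯
        τ = run everyone (λ i _ → i) 0
        tef : IsTef 𝒯 τ
        tef = run-initial {everyone} {λ i _ → i} (proj₁ (inhabited y₀) , refl)
        at : At τ 1 (λ _ → 0)
        at t = refl
        nonzero : ∀ t → 0 ≢ toℕ (Path.σ (proj₁ t) (τ 1 t))
        nonzero t eq with trans eq (cong toℕ (σ-after (proj₁ t) 0))
        ... | ()
        placed-zero : ∀ z → 0 ≡ placed 0 z
        placed-zero zero    = refl
        placed-zero (suc _) = refl

      correct : ∀ n → (∃[ w ] Sat w (placed n) φ) ⇔ ModelChecking (sentence n , K)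
      correct n = mk⇔ (complete n) (sound n)

-- Triangular marks

true≢false : ∀ {b} → b ≡ true → b ≢ false
true≢false refl ()

Gap : (ℕ → Bool) → ℕ → ℕ → Set
Gap M a n = (∀ r → r < n → M (r + suc a) ≡ false) × M (n + suc a) ≡ true

-- Since `triangle (suc n)` equals `n + suc (triangle n)`, the gap after each triangular number ends
-- exactly at the next one, so these are all the marks.
Triangular : (ℕ → Bool) → Set
Triangular M = M 0 ≡ true × (∀ n → Gap M (triangle n) n)

gap-unique : ∀ {M a m n} → Gap M a m → Gap M a n → m ≡ n
gap-unique {m = m} {n} (low , one) (low′ , one′) with <-cmp m n
... | tri< m<n _ _ = ⊥-elim (true≢false one (low′ m m<n))
... | tri≈ _ eq _  = eq
... | tri> _ _ n<m = ⊥-elim (true≢false one′ (low n n<m))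

m≤triangle : ∀ n → n ≤ triangle n
m≤triangle zero    = z≤n
m≤triangle (suc n) = m≤m+n (suc n) (triangle n)

triangle-+ : ∀ m n → triangle m + triangle n + m * n ≡ triangle (m + n)
triangle-+ zero    n = +-identityʳ (triangle n)
triangle-+ (suc m) n = trans (arrange m n (triangle m) (triangle n)) (cong (suc (m + n) +_) (triangle-+ m n))
  where
  arrange : ∀ m n s t → suc m + s + t + suc m * n ≡ suc (m + n) + (s + t + m * n)
  arrange = solve-∀

-- The blocks from `triangle n` to `n + triangle n` follow each other without a hole. So a number
-- that is not triangular lies inside a gap.
triangle-decompose : ∀ j → ∃[ n ] ∃[ r ] r ≤ n × j ≡ r + triangle n
triangle-decompose zero    = 0 , 0 , z≤n , refl
triangle-decompose (suc j) with triangle-decompose j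
... | n , r , r≤n , refl with m≤n⇒m<n∨m≡n r≤n
...   | inj₁ r<n  = n , suc r , r<n , refl
...   | inj₂ refl = suc n , 0 , z≤n , refl

module _ {M : ℕ → Bool} (triangular : Triangular M) where

  triangle-marked : ∀ n → M (triangle n) ≡ true
  triangle-marked zero    = proj₁ triangular
  triangle-marked (suc n) = subst (λ j → M j ≡ true) (+-suc n (triangle n)) (proj₂ (proj₂ triangular n))

  marked-triangle : ∀ j → M j ≡ true → ∃[ n ] j ≡ triangle n
  marked-triangle j marked with triangle-decompose j
  ... | n , zero  , _   , eq   = n , eq
  ... | n , suc r , r<n , refl = ⊥-elim (true≢false marked
          (subst (λ j → M j ≡ false) (+-suc r (triangle n)) (proj₁ (proj₂ triangular n) r r<n)))

  -- The word is not ultimately periodic: shift p to triangle q; then q lands inside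
  -- the gap after triangle q.
  separated : ∀ {p q} → p < q → ∃[ k ] M (k + p) ≢ M (k + q)
  separated {p} {q} p<q with m≤n⇒∃[o]m+o≡n p<q | m≤n⇒∃[o]m+o≡n (≤-trans (<⇒≤ p<q) (m≤triangle q))
  ... | d , refl | e , p+e≡ = e , λ eq →
    true≢false (triangle-marked q)
      (trans (cong M (sym (trans (+-comm e p) p+e≡)))
        (trans eq (trans (cong M shift) (proj₁ (proj₂ triangular q) d (s≤s (m≤n+m d p))))))
    where
    arrange : ∀ e p d → e + suc (p + d) ≡ d + suc (p + e)
    arrange = solve-∀
    shift : e + suc (p + d) ≡ d + suc (triangle q)
    shift = trans (arrange e p d) (cong (λ t → d + suc t) p+e≡)

  same-marks : ∀ {p q} → (∀ k → M (k + p) ≡ M (k + q)) → p ≡ q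
  same-marks {p} {q} same with <-cmp p q
  ... | tri< p<q _ _ = let k , differ = separated p<q in ⊥-elim (differ (same k))
  ... | tri≈ _ eq _  = eq
  ... | tri> _ _ q<p = let k , differ = separated q<p in ⊥-elim (differ (sym (same k)))

  -- Exactly `n` unmarked places follow the mark at `triangle n`, so the index of a triangular
  -- number can be read off by counting.
  gap-triangle : ∀ {x y} → (M x ≡ true × Gap M x y) ⇔ x ≡ triangle y
  gap-triangle {x} {y} = mk⇔ forth λ { refl → triangle-marked y , proj₂ triangular y }
    where
    forth : M x ≡ true × Gap M x y → x ≡ triangle y
    forth (marked , gap) with marked-triangle x marked
    ... | n , refl = cong triangle (gap-unique {M} (proj₂ triangular n) gap)

-- A local form of `Triangular` that walkers can check: the gap after 0 is empty, and past any mark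
-- the second gap is longer by one than the first. Here `k + suc a` is the mark between the two
-- gaps.
Growing : (ℕ → Bool) → Set
Growing M = M 0 ≡ true × M 1 ≡ true ×
            (∀ a → M a ≡ false ⊎ (∃[ k ] Gap M a k × Gap M (k + suc a) (suc k)))

growing⇔triangular : ∀ {M} → Growing M ⇔ Triangular M
growing⇔triangular {M} = mk⇔ (λ g → proj₁ g , gaps g) grow
  where
  gaps : Growing M → ∀ n → Gap M (triangle n) n
  gaps (_ , m₁ , _) zero = (λ _ ()) , m₁
  gaps g@(m₀ , m₁ , grows) (suc n) with gaps g n | grows (triangle n)
  -- The length `k` is only claimed to exist; uniqueness of gaps identifies it with `n`.
  ... | gap | inj₂ (k , gap′ , gap″) with gap-unique {M} gap gap′
  ...   | refl = subst (λ a → Gap M a (suc n)) (+-suc n (triangle n)) gap″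
  gaps g@(m₀ , m₁ , grows) (suc n) | gap | inj₁ off = ⊥-elim (true≢false (on n) off)
    where
    on : ∀ n → M (triangle n) ≡ true
    on zero = m₀
    on (suc n) = subst (λ j → M j ≡ true) (+-suc n (triangle n)) (proj₂ (gaps g n))
  grow : Triangular M → Growing M
  grow t@(m₀ , gaps) = m₀ , proj₂ (gaps 0) , grows
    where
    grows : ∀ a → M a ≡ false ⊎ (∃[ k ] Gap M a k × Gap M (k + suc a) (suc k))
    grows a with M a in eq
    ... | false = inj₁ refl
    ... | true with marked-triangle {M} t a eq
    ...   | n , refl = inj₂ (n , gaps n , subst (λ a → Gap M a (suc n)) (sym (+-suc n (triangle n))) (gaps (suc n)))

⇔-trans : {P Q R : Set} → P ⇔ Q → Q ⇔ R → P ⇔ R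
⇔-trans f g = mk⇔ (to g ∘ to f) (from f ∘ from g)

∃-⇔ : {P Q : ℕ → Set} → (∀ n → P n ⇔ Q n) → (∃[ n ] P n) ⇔ (∃[ n ] Q n)
∃-⇔ h = mk⇔ (λ (n , p) → n , to (h n) p) (λ (n , q) → n , from (h n) q)

∀-⇔ : {P Q : ℕ → Set} → (∀ n → P n ⇔ Q n) → (∀ n → P n) ⇔ (∀ n → Q n)
∀-⇔ h = mk⇔ (λ p n → to (h n) (p n)) (λ q n → from (h n) (q n))

≢⇒≡ᵇ : ∀ {m n} → m ≢ n → (m ≡ᵇ n) ≡ false
≢⇒≡ᵇ {m} {n} m≢n with m ≡ᵇ n in eq
... | true  = ⊥-elim (m≢n (≡ᵇ⇒≡ m n (from Boolₚ.T-≡ eq)))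
... | false = refl

move-first : ∀ x y k ps → move (among x y) k ps x ≡ k + ps x
move-first x y k ps rewrite ≡ᵇ-refl x = refl

move-second : ∀ x y k ps → move (among x y) k ps y ≡ k + ps y
move-second x y k ps rewrite ≡ᵇ-refl y | Boolₚ.∨-zeroʳ (y ≡ᵇ x) = refl

move-other : ∀ {x y z} k ps → z ≢ x → z ≢ y → move (among x y) k ps z ≡ ps z
move-other k ps z≢x z≢y rewrite ≢⇒≡ᵇ z≢x | ≢⇒≡ᵇ z≢y = refl

-- First-order logic by walkers

-- A relational language in negation normal form, because `Walk` has neither terms nor negation.
-- Only equality and membership need a negated form, as compound terms get evaluated through
-- quantified intermediate values.
data FO (k : ℕ) : ℕ → Set where
  eqᶠ neqᶠ sucᶠ triᶠ : ∀ {m} → Fin m → Fin m → FO k m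
  sumᶠ               : ∀ {m} → Fin m → Fin m → Fin m → FO k m
  inᶠ ninᶠ           : ∀ {m} → Fin k → Fin m → FO k m
  _∧ᶠ_ _∨ᶠ_          : ∀ {m} → FO k m → FO k m → FO k m
  ∀ᶠ ∃ᶠ              : ∀ {m} → FO k (suc m) → FO k m

infixr 6 _∧ᶠ_
infixr 5 _∨ᶠ_

⟪_⟫ : ∀ {k m} → FO k m → (Fin k → ℕ → Bool) → Vec ℕ m → Set
⟪ eqᶠ x y    ⟫ Xs ρ = lookup ρ x ≡ lookup ρ y
⟪ neqᶠ x y   ⟫ Xs ρ = lookup ρ x ≢ lookup ρ y
⟪ sucᶠ x y   ⟫ Xs ρ = suc (lookup ρ x) ≡ lookup ρ y
⟪ triᶠ x y   ⟫ Xs ρ = lookup ρ x ≡ triangle (lookup ρ y)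
⟪ sumᶠ x y z ⟫ Xs ρ = lookup ρ x + lookup ρ y ≡ lookup ρ z
⟪ inᶠ X x    ⟫ Xs ρ = Xs X (lookup ρ x) ≡ true
⟪ ninᶠ X x   ⟫ Xs ρ = Xs X (lookup ρ x) ≡ false
⟪ φ ∧ᶠ ψ     ⟫ Xs ρ = ⟪ φ ⟫ Xs ρ × ⟪ ψ ⟫ Xs ρ
⟪ φ ∨ᶠ ψ     ⟫ Xs ρ = ⟪ φ ⟫ Xs ρ ⊎ ⟪ ψ ⟫ Xs ρ
⟪ ∀ᶠ φ       ⟫ Xs ρ = ∀ n → ⟪ φ ⟫ Xs (n ∷ ρ)
⟪ ∃ᶠ φ       ⟫ Xs ρ = ∃[ n ] ⟪ φ ⟫ Xs (n ∷ ρ)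

-- De Bruijn levels serve as walkers, so that the walkers from m on are unused and
-- still stand at 0.
level : ∀ {m} → Fin m → ℕ
level {suc m} zero    = m
level {suc m} (suc i) = level i

level-< : ∀ {m} (i : Fin m) → level i < m
level-< {suc m} zero    = n<1+n m
level-< {suc m} (suc i) = m≤n⇒m≤1+n (level-< i)

module Compilation {A k : ℕ} (mark : Fin A → Bool) (member : Fin k → Fin A → Bool) where

  on off any : ℕ → Walk A
  on  = atom mark true
  off = atom mark false
  any = atom (λ _ → true) true

  eventually : ℕ → ℕ → Walk A → Walk A
  eventually x y = until x y (any x)

  meet differ : ℕ → ℕ → Walk A
  meet   x y = always x y ((on x ∧ʷ on y) ∨ʷ (off x ∧ʷ off y))
  differ x y = eventually x y ((on x ∧ʷ off y) ∨ʷ (off x ∧ʷ on y))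

  -- Sends the fresh walker d to the place of x, so that φ can move d instead of x.
  withCopy : ℕ → ℕ → Walk A → Walk A
  withCopy d x φ = eventually d d (meet d x ∧ʷ φ)

  -- Walker 0 holds the input, so walkers 1 and 2 do the work. From an arbitrary mark, walker 2
  -- first runs to the next mark; then both cross their gaps in lockstep, and walker 2 must find its
  -- mark exactly one step later than walker 1.
  growing : Walk A
  growing = on 1 ∧ʷ next 1 1 (on 1) ∧ʷ always 1 2 (off 1 ∨ʷ next 1 2 (until 2 2 (off 2)
    (on 2 ∧ʷ next 2 2 (until 1 2 (off 1 ∧ʷ off 2) (on 1 ∧ʷ off 2 ∧ʷ next 2 2 (on 2))))))

  -- In `sucᶠ`, `triᶠ` and `sumᶠ` the fresh walker `m` becomes a copy of `x`. In the last two,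
  -- walker `suc m` starts at 0 and counts the steps of that copy; when it meets `y`, the copy has
  -- crossed a gap of length `y` or has reached the sum.
  compile : ∀ {m} → FO k m → Walk A
  compile (eqᶠ x y)  = meet (level x) (level y)
  compile (neqᶠ x y) = differ (level x) (level y)
  compile {m} (sucᶠ x y) = withCopy m (level x) (next m m (meet m (level y)))
  compile {m} (triᶠ x y) = withCopy m (level x) (on m ∧ʷ
    next m m (until m (suc m) (off m) (on m ∧ʷ meet (suc m) (level y))))
  compile {m} (sumᶠ x y z) = withCopy m (level x)
    (eventually m (suc m) (meet (suc m) (level y) ∧ʷ meet m (level z)))
  compile (inᶠ X x)  = atom (member X) true (level x)
  compile (ninᶠ X x) = atom (member X) false (level x)
  compile (φ ∧ᶠ ψ)   = compile φ ∧ʷ compile ψ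
  compile (φ ∨ᶠ ψ)   = compile φ ∨ʷ compile ψ
  compile {m} (∀ᶠ φ) = always m m (compile φ)
  compile {m} (∃ᶠ φ) = eventually m m (compile φ)

  module _ (w : ℕ → Fin A) where

    M : ℕ → Bool
    M j = mark (w j)

    eventually-⇔ : ∀ x y φ {ps} → Sat w ps (eventually x y φ) ⇔ (∃[ j ] Sat w (move (among x y) j ps) φ)
    eventually-⇔ x y φ = mk⇔ (λ (j , s , _) → j , s) (λ (j , s) → j , s , λ _ _ → refl)

    growing-⇔ : ∀ n → Sat w (placed n) growing ⇔ Growing M
    growing-⇔ n = mk⇔ forth back
      where
      -- The scope of `always` unfolds to this at the place `a + 0`.
      Body : ℕ → Set
      Body a = M a ≡ false ⊎ (∃[ k ] (M (k + suc a) ≡ true ×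
        (∃[ l ] (M (l + suc a) ≡ true × M (l + suc (k + suc a)) ≡ false × M (suc (l + suc (k + suc a))) ≡ true) ×
                (∀ j → j < l → M (j + suc a) ≡ false × M (j + suc (k + suc a)) ≡ false)))
        × (∀ j → j < k → M (j + suc a) ≡ false))
      forth : Sat w (placed n) growing → Growing M
      forth (m₀ , m₁ , h) = m₀ , m₁ , λ a → convert a (subst Body (+-identityʳ a) (h a))
        where
        convert : ∀ a → Body a → M a ≡ false ⊎ (∃[ k ] Gap M a k × Gap M (k + suc a) (suc k))
        convert a (inj₁ m) = inj₁ m
        -- Walker 1 crosses in `l` steps the gap that walker 2 has crossed before in `k` steps, so
        -- both numbers agree.
        convert a (inj₂ (k , (onₖ , l , (onₗ , offₗ , last) , between) , before))
          with gap-unique {M} (before , onₖ) ((λ j j<l → proj₁ (between j j<l)) , onₗ)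
        ... | refl = inj₂ (k , (before , onₖ) , low , last)
          where
          low : ∀ r → r < suc k → M (r + suc (k + suc a)) ≡ false
          low r r<1+k with m≤n⇒m<n∨m≡n r<1+k
          ... | inj₁ (s≤s r<k) = proj₂ (between r r<k)
          ... | inj₂ refl      = offₗ
      back : Growing M → Sat w (placed n) growing
      back (m₀ , m₁ , h) = m₀ , m₁ , λ a → subst Body (sym (+-identityʳ a)) (convert a (h a))
        where
        convert : ∀ a → M a ≡ false ⊎ (∃[ k ] Gap M a k × Gap M (k + suc a) (suc k)) → Body a
        convert a (inj₁ m) = inj₁ m
        convert a (inj₂ (k , (before , onₖ) , low , last)) = inj₂ (k , (onₖ , k ,
          (onₖ , low k ≤-refl , last) , λ j j<k → before j j<k , low j (m≤n⇒m≤1+n j<k)) , before)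

    module _ (triangular : Triangular M) where

      private
        both : ∀ {a b} → (a ≡ true × b ≡ true) ⊎ (a ≡ false × b ≡ false) → a ≡ b
        both (inj₁ (p , q)) = trans p (sym q)
        both (inj₂ (p , q)) = trans p (sym q)
        same : ∀ a b → a ≡ b → (a ≡ true × b ≡ true) ⊎ (a ≡ false × b ≡ false)
        same true  _ eq = inj₁ (refl , sym eq)
        same false _ eq = inj₂ (refl , sym eq)
        apart : ∀ {a b} → (a ≡ true × b ≡ false) ⊎ (a ≡ false × b ≡ true) → a ≢ b
        apart (inj₁ (refl , refl)) ()
        apart (inj₂ (refl , refl)) ()
        diff : ∀ a b → a ≢ b → (a ≡ true × b ≡ false) ⊎ (a ≡ false × b ≡ true)
        diff true  true  ≢ = ⊥-elim (≢ refl)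
        diff true  false _ = inj₁ (refl , refl)
        diff false true  _ = inj₂ (refl , refl)
        diff false false ≢ = ⊥-elim (≢ refl)

      meet-⇔ : ∀ x y {ps} → Sat w ps (meet x y) ⇔ ps x ≡ ps y
      meet-⇔ x y {ps} = mk⇔
        (λ h → same-marks {M} triangular λ j → subst₂ (λ a b → M a ≡ M b)
          (move-first x y j ps) (move-second x y j ps) (both (h j)))
        (λ eq j → same _ _ (cong M (trans (move-first x y j ps)
          (trans (cong (j +_) eq) (sym (move-second x y j ps))))))

      differ-⇔ : ∀ x y {ps} → Sat w ps (differ x y) ⇔ ps x ≢ ps y
      differ-⇔ x y {ps} = mk⇔
        (λ (j , h , _) eq → apart h (cong M (trans (move-first x y j ps)
          (trans (cong (j +_) eq) (sym (move-second x y j ps))))))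
        (λ ≢ → let j , d = somewhere ≢ in j , diff _ _ (λ eq → d (subst₂ (λ a b → M a ≡ M b)
          (move-first x y j ps) (move-second x y j ps) eq)) , λ _ _ → refl)
        where
        somewhere : ps x ≢ ps y → ∃[ j ] M (j + ps x) ≢ M (j + ps y)
        somewhere ≢ with <-cmp (ps x) (ps y)
        ... | tri< lt _ _ = separated {M} triangular lt
        ... | tri≈ _ eq _ = ⊥-elim (≢ eq)
        ... | tri> _ _ gt = let j , d = separated {M} triangular gt in j , d ∘ sym

      withCopy-⇔ : ∀ {d x} φ {ps} → ps d ≡ 0 → x ≢ d →
                   Sat w ps (withCopy d x φ) ⇔ Sat w (move (among d d) (ps x) ps) φ
      withCopy-⇔ {d} {x} φ {ps} rest x≢d = mk⇔
        (λ (j , (m , s) , _) → subst (λ j → Sat w (move (among d d) j ps) φ)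
           (trans (sym (at-d j)) (trans (to (meet-⇔ d x {move (among d d) j ps}) m) (at-x j))) s)
        (λ s → ps x , (from (meet-⇔ d x {move (among d d) (ps x) ps}) (trans (at-d (ps x)) (sym (at-x (ps x)))) , s) , λ _ _ → refl)
        where
        at-d : ∀ j → move (among d d) j ps d ≡ j
        at-d j = trans (move-first d d j ps) (trans (cong (j +_) rest) (+-identityʳ j))
        at-x : ∀ j → move (among d d) j ps x ≡ ps x
        at-x j = move-other j ps x≢d x≢d

      Env : ∀ {m} → (ℕ → ℕ) → Vec ℕ m → Set
      Env {m} ps ρ = (∀ i → ps (level i) ≡ lookup ρ i) × (∀ z → m ≤ z → ps z ≡ 0)

      env-extend : ∀ {m ps} {ρ : Vec ℕ m} → Env ps ρ → ∀ n → Env (move (among m m) n ps) (n ∷ ρ)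
      env-extend {m} {ps} {ρ} (held , rest) n = held′ , rest′
        where
        held′ : ∀ i → move (among m m) n ps (level i) ≡ lookup (n ∷ ρ) i
        held′ zero    = trans (move-first m m n ps) (trans (cong (n +_) (rest m ≤-refl)) (+-identityʳ n))
        held′ (suc i) = trans (move-other n ps (<⇒≢ (level-< i)) (<⇒≢ (level-< i))) (held i)
        rest′ : ∀ z → suc m ≤ z → move (among m m) n ps z ≡ 0
        rest′ z m<z = trans (move-other n ps (>⇒≢ m<z) (>⇒≢ m<z)) (rest z (<⇒≤ m<z))

      module _ {m : ℕ} {ps : ℕ → ℕ} {ρ : Vec ℕ m} (env : Env ps ρ) where

        private
          rest-m : ps m ≡ 0
          rest-m = proj₂ env m ≤-refl

          old : ∀ (i : Fin m) {z} → m ≤ z → level i ≢ z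
          old i m≤z = <⇒≢ (<-≤-trans (level-< i) m≤z)

          copied : Fin m → Vec ℕ (suc m)
          copied x = ps (level x) ∷ ρ

          env′ : ∀ (x : Fin m) → Env (move (among m m) (ps (level x)) ps) (copied x)
          env′ x = env-extend env (ps (level x))

        suc-⇔ : ∀ x y → Sat w ps (compile (sucᶠ x y)) ⇔ ⟪ sucᶠ x y ⟫ (λ X j → member X (w j)) ρ
        suc-⇔ x y = ⇔-trans (withCopy-⇔ (next m m (meet m (level y))) {ps} rest-m (old x ≤-refl))
          (⇔-trans (meet-⇔ m (level y) {move (among m m) 1 q})
          (subst₂ (λ a b → (a ≡ b) ⇔ (suc (lookup ρ x) ≡ lookup ρ y)) (sym at-m) (sym at-y) (mk⇔ id id)))
          where
          q : ℕ → ℕ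
          q = move (among m m) (ps (level x)) ps
          at-m : move (among m m) 1 q m ≡ suc (lookup ρ x)
          at-m = trans (move-first m m 1 q) (cong suc (trans (proj₁ (env′ x) zero) (proj₁ env x)))
          at-y : move (among m m) 1 q (level y) ≡ lookup ρ y
          at-y = trans (move-other 1 q (old y ≤-refl) (old y ≤-refl)) (proj₁ (env′ x) (suc y))

        module _ (x : Fin m) where
          private
            q : ℕ → ℕ
            q = move (among m m) (ps (level x)) ps
            at-m : q m ≡ lookup ρ x
            at-m = trans (proj₁ (env′ x) zero) (proj₁ env x)
            at-suc : q (suc m) ≡ 0
            at-suc = proj₂ (env′ x) (suc m) ≤-refl

          sum-⇔ : ∀ y z → Sat w ps (compile (sumᶠ x y z)) ⇔ ⟪ sumᶠ x y z ⟫ (λ X j → member X (w j)) ρ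
          sum-⇔ y z = ⇔-trans (withCopy-⇔ body {ps} rest-m (old x ≤-refl)) (mk⇔ forth back)
            where
            body : Walk A
            body = eventually m (suc m) (meet (suc m) (level y) ∧ʷ meet m (level z))
            p : ℕ → ℕ → ℕ
            p j = move (among m (suc m)) j q
            p-m : ∀ j → p j m ≡ j + lookup ρ x
            p-m j = trans (move-first m (suc m) j q) (cong (j +_) at-m)
            p-suc : ∀ j → p j (suc m) ≡ j
            p-suc j = trans (move-second m (suc m) j q) (trans (cong (j +_) at-suc) (+-identityʳ j))
            p-old : ∀ i j → p j (level i) ≡ lookup ρ i
            p-old i j = trans (move-other j q (old i ≤-refl) (old i (n≤1+n m))) (proj₁ (env′ x) (suc i))
            forth : Sat w q body → lookup ρ x + lookup ρ y ≡ lookup ρ z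
            forth (j , (hy , hz) , _)
              with trans (sym (p-suc j)) (trans (to (meet-⇔ (suc m) (level y) {p j}) hy) (p-old y j))
            ... | refl = trans (+-comm (lookup ρ x) j)
                           (trans (sym (p-m j)) (trans (to (meet-⇔ m (level z) {p j}) hz) (p-old z j)))
            back : lookup ρ x + lookup ρ y ≡ lookup ρ z → Sat w q body
            back eq = j , (from (meet-⇔ (suc m) (level y) {p j}) (trans (p-suc j) (sym (p-old y j))) ,
                           from (meet-⇔ m (level z) {p j}) (trans (p-m j)
                             (trans (+-comm j (lookup ρ x)) (trans eq (sym (p-old z j)))))) , λ _ _ → refl
              where
              j : ℕ
              j = lookup ρ y

          tri-⇔ : ∀ y → Sat w ps (compile (triᶠ x y)) ⇔ ⟪ triᶠ x y ⟫ (λ X j → member X (w j)) ρ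
          tri-⇔ y = ⇔-trans (withCopy-⇔ body {ps} rest-m (old x ≤-refl))
                      (⇔-trans (mk⇔ forth back) (gap-triangle {M} triangular))
            where
            body : Walk A
            body = on m ∧ʷ next m m (until m (suc m) (off m) (on m ∧ʷ meet (suc m) (level y)))
            q′ : ℕ → ℕ
            q′ = move (among m m) 1 q
            p : ℕ → ℕ → ℕ
            p j = move (among m (suc m)) j q′
            p-m : ∀ j → p j m ≡ j + suc (lookup ρ x)
            p-m j = trans (move-first m (suc m) j q′)
                      (cong (j +_) (trans (move-first m m 1 q) (cong suc at-m)))
            p-suc : ∀ j → p j (suc m) ≡ j
            p-suc j = trans (move-second m (suc m) j q′)
                        (trans (cong (j +_) (trans (move-other 1 q 1+n≢n 1+n≢n) at-suc)) (+-identityʳ j))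
            p-old : ∀ i j → p j (level i) ≡ lookup ρ i
            p-old i j = trans (move-other j q′ (old i ≤-refl) (old i (n≤1+n m)))
                          (trans (move-other 1 q (old i ≤-refl) (old i ≤-refl)) (proj₁ (env′ x) (suc i)))
            forth : Sat w q body → M (lookup ρ x) ≡ true × Gap M (lookup ρ x) (lookup ρ y)
            forth (marked , j , (hm , hy) , low)
              with trans (sym (p-suc j)) (trans (to (meet-⇔ (suc m) (level y) {p j}) hy) (p-old y j))
            ... | refl = trans (cong M (sym at-m)) marked ,
                         (λ r r<j → trans (cong M (sym (p-m r))) (low r r<j)) , trans (cong M (sym (p-m j))) hm
            back : M (lookup ρ x) ≡ true × Gap M (lookup ρ x) (lookup ρ y) → Sat w q body
            back (marked , low , hm) = trans (cong M at-m) marked , j ,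
              (trans (cong M (p-m j)) hm , from (meet-⇔ (suc m) (level y) {p j}) (trans (p-suc j) (sym (p-old y j)))) ,
              λ r r<j → trans (cong M (p-m r)) (low r r<j)
              where
              j : ℕ
              j = lookup ρ y

      compile-⇔ : ∀ {m} (φ : FO k m) {ps ρ} → Env ps ρ →
                  Sat w ps (compile φ) ⇔ ⟪ φ ⟫ (λ X j → member X (w j)) ρ
      compile-⇔ (eqᶠ x y) {ps} {ρ} (held , _) =
        subst₂ (λ a b → Sat w ps (meet (level x) (level y)) ⇔ (a ≡ b)) (held x) (held y) (meet-⇔ _ _ {ps})
      compile-⇔ (neqᶠ x y) {ps} {ρ} (held , _) =
        subst₂ (λ a b → Sat w ps (differ (level x) (level y)) ⇔ (a ≢ b)) (held x) (held y) (differ-⇔ _ _ {ps})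
      compile-⇔ (sucᶠ x y)   {ρ = ρ} env = suc-⇔ {ρ = ρ} env x y
      compile-⇔ (triᶠ x y)   {ρ = ρ} env = tri-⇔ {ρ = ρ} env x y
      compile-⇔ (sumᶠ x y z) {ρ = ρ} env = sum-⇔ {ρ = ρ} env x y z
      compile-⇔ (inᶠ X x)  {ps} (held , _) =
        subst (λ a → (member X (w (ps (level x))) ≡ true) ⇔ (member X (w a) ≡ true)) (held x) (mk⇔ id id)
      compile-⇔ (ninᶠ X x) {ps} (held , _) =
        subst (λ a → (member X (w (ps (level x))) ≡ false) ⇔ (member X (w a) ≡ false)) (held x) (mk⇔ id id)
      compile-⇔ (φ ∧ᶠ ψ) env = compile-⇔ φ env ×-⇔ compile-⇔ ψ env
      compile-⇔ (φ ∨ᶠ ψ) env = compile-⇔ φ env ⊎-⇔ compile-⇔ ψ env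
      compile-⇔ (∀ᶠ φ) env = ∀-⇔ λ n → compile-⇔ φ (env-extend env n)
      compile-⇔ {m} (∃ᶠ φ) env =
        ⇔-trans (eventually-⇔ m m (compile φ)) (∃-⇔ λ n → compile-⇔ φ (env-extend env n))

-- Arithmetical formulas

triangle-mono-≤ : ∀ {m n} → m ≤ n → triangle m ≤ triangle n
triangle-mono-≤ z≤n       = z≤n
triangle-mono-≤ (s≤s m≤n) = +-mono-≤ (s≤s m≤n) (triangle-mono-≤ m≤n)

-- The number lies strictly between `triangle n` and `triangle (suc n)`.
gap-not-triangle : ∀ {r n} m → r < n → r + suc (triangle n) ≢ triangle m
gap-not-triangle {r} {n} m r<n eq with ≤-<-connex m n
... | inj₁ m≤n = <⇒≱ (≤-trans (s≤s (triangle-mono-≤ m≤n)) (m≤n+m (suc (triangle n)) r)) (≤-reflexive eq)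
... | inj₂ n<m = <⇒≱ (<-≤-trans (+-monoˡ-< (suc (triangle n)) r<n)
                       (≤-trans (≤-reflexive (+-suc n (triangle n))) (triangle-mono-≤ n<m))) (≤-reflexive (sym eq))

triangular-exists : ExcludedMiddle 0ℓ → ∃[ M ] Triangular M
triangular-exists em = M , marked 0 , λ n →
  (λ r r<n → unmarked λ (m , eq) → gap-not-triangle m r<n eq) ,
  subst (λ j → M j ≡ true) (sym (+-suc n (triangle n))) (marked (suc n))
  where
  M : ℕ → Bool
  M j = ⌊ em {P = ∃[ n ] j ≡ triangle n} ⌋
  marked : ∀ n → M (triangle n) ≡ true
  marked n = to Boolₚ.T-≡ (fromWitness (n , refl))
  unmarked : ∀ {j} → ¬ (∃[ n ] j ≡ triangle n) → M j ≡ false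
  unmarked ¬tri = Boolₚ.¬-not λ eq → ¬tri (toWitness (from Boolₚ.T-≡ eq))

private
  v₀ : ∀ {n} → Fin (1 + n)
  v₀ = zero
  v₁ : ∀ {n} → Fin (2 + n)
  v₁ = suc zero
  v₂ : ∀ {n} → Fin (3 + n)
  v₂ = suc (suc zero)

suc² : ∀ {n} → Fin n → Fin (2 + n)
suc² i = suc (suc i)

one-point : ∀ {a} {P Q : ℕ → Set} → (∀ x → P x ⇔ (a ≡ x)) → (∃[ x ] P x × Q x) ⇔ Q a
one-point {a} {Q = Q} h = mk⇔ (λ (x , p , q) → subst Q (sym (to (h x) p)) q) (λ q → a , from (h a) refl , q)

module _ {k : ℕ} where

  -- T (x + y) = T x + T y + x y for the triangular numbers T.
  prodᶠ : ∀ {m} → Fin m → Fin m → Fin m → FO k m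
  prodᶠ x y z = ∃ᶠ (triᶠ v₀ (suc x) ∧ᶠ ∃ᶠ (triᶠ v₀ (suc (suc y)) ∧ᶠ ∃ᶠ (sumᶠ v₂ v₁ v₀ ∧ᶠ
    ∃ᶠ (sumᶠ (suc (suc (suc (suc x)))) (suc (suc (suc (suc y)))) v₀ ∧ᶠ
    ∃ᶠ (triᶠ v₀ v₁ ∧ᶠ sumᶠ v₂ (suc (suc (suc (suc (suc z))))) v₀)))))

  -- The renaming `r` takes the variables of the term past the quantifiers that hold intermediate
  -- values.
  value : ∀ {m m′} → Term m → (Fin m → Fin m′) → Fin m′ → FO k m′
  value (var i) r v = eqᶠ (r i) v
  -- Zero is the only number that equals its own double.
  value 𝟎       r v = sumᶠ v v v
  value (𝐬 t)   r v = ∃ᶠ (value t (suc ∘ r) v₀ ∧ᶠ sucᶠ v₀ (suc v))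
  value (s ⊕ t) r v = ∃ᶠ (value s (suc ∘ r) v₀ ∧ᶠ
                        ∃ᶠ (value t (suc² ∘ r) v₀ ∧ᶠ sumᶠ v₁ v₀ (suc (suc v))))
  value (s ⊗ t) r v = ∃ᶠ (value s (suc ∘ r) v₀ ∧ᶠ
                        ∃ᶠ (value t (suc² ∘ r) v₀ ∧ᶠ prodᶠ v₁ v₀ (suc (suc v))))

  -- Negation is pushed down to the atoms. Refuted atoms may keep `∃ᶠ` for the values of their
  -- terms, since each term has exactly one value.
  affirm refute : ∀ {m} → Arith k m → FO k m
  affirm (s ≐ t)  = ∃ᶠ (value s suc v₀ ∧ᶠ ∃ᶠ (value t suc² v₀ ∧ᶠ eqᶠ v₁ v₀))
  affirm (t ∈̇ X)  = ∃ᶠ (value t suc v₀ ∧ᶠ inᶠ X v₀)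
  affirm (¬̇ α)    = refute α
  affirm (α ∧̇ β)  = affirm α ∧ᶠ affirm β
  affirm (α ∨̇ β)  = affirm α ∨ᶠ affirm β
  affirm (∀̇ α)    = ∀ᶠ (affirm α)
  affirm (∃̇ α)    = ∃ᶠ (affirm α)
  refute (s ≐ t)  = ∃ᶠ (value s suc v₀ ∧ᶠ ∃ᶠ (value t suc² v₀ ∧ᶠ neqᶠ v₁ v₀))
  refute (t ∈̇ X)  = ∃ᶠ (value t suc v₀ ∧ᶠ ninᶠ X v₀)
  refute (¬̇ α)    = affirm α
  refute (α ∧̇ β)  = refute α ∨ᶠ refute β
  refute (α ∨̇ β)  = refute α ∧ᶠ refute β
  refute (∀̇ α)    = ∃ᶠ (refute α)
  refute (∃̇ α)    = ∀ᶠ (refute α)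

  module _ {Xs : Fin k → ℕ → Bool} where

    prod-⇔ : ∀ {m} (x y z : Fin m) {ρ} → ⟪ prodᶠ x y z ⟫ Xs ρ ⇔ (lookup ρ x * lookup ρ y ≡ lookup ρ z)
    prod-⇔ x y z {ρ} = mk⇔
      (λ { (_ , refl , _ , refl , _ , refl , _ , refl , _ , refl , eq) →
           +-cancelˡ-≡ (triangle a + triangle b) (a * b) (lookup ρ z) (trans (triangle-+ a b) (sym eq)) })
      (λ eq → _ , refl , _ , refl , _ , refl , _ , refl , _ , refl ,
              trans (cong (triangle a + triangle b +_) (sym eq)) (triangle-+ a b))
      where
      a b : ℕ
      a = lookup ρ x
      b = lookup ρ y

    value-⇔ : ∀ {m m′} (t : Term m) (r : Fin m → Fin m′) v {ρ ρ′} → (∀ i → lookup ρ′ (r i) ≡ lookup ρ i) →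
              ⟪ value t r v ⟫ Xs ρ′ ⇔ (⟦ t ⟧ᵗ ρ ≡ lookup ρ′ v)
    value-⇔ (var i) r v {ρ} {ρ′} h = subst (λ a → (lookup ρ′ (r i) ≡ lookup ρ′ v) ⇔ (a ≡ lookup ρ′ v)) (h i) (mk⇔ id id)
    value-⇔ 𝟎 r v {ρ} {ρ′} h = mk⇔ (λ eq → sym (m+n≡m⇒n≡0 (lookup ρ′ v) eq))
                                     (λ eq → subst (λ a → a + a ≡ a) eq refl)
      where
      m+n≡m⇒n≡0 : ∀ m {n} → m + n ≡ m → n ≡ 0
      m+n≡m⇒n≡0 m {n} eq = +-cancelˡ-≡ m n 0 (trans eq (sym (+-identityʳ m)))
    value-⇔ (𝐬 t) r v h = one-point λ x → value-⇔ t (suc ∘ r) v₀ h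
    value-⇔ (s ⊕ t) r v h = ⇔-trans (one-point λ x → value-⇔ s (suc ∘ r) v₀ h)
                                     (one-point λ y → value-⇔ t (suc² ∘ r) v₀ h)
    value-⇔ (s ⊗ t) r v {ρ} {ρ′} h = ⇔-trans (one-point λ x → value-⇔ s (suc ∘ r) v₀ h)
                                     (⇔-trans (one-point λ y → value-⇔ t (suc² ∘ r) v₀ h)
                                       (prod-⇔ v₁ v₀ (suc (suc v)) {⟦ t ⟧ᵗ ρ ∷ ⟦ s ⟧ᵗ ρ ∷ ρ′}))

    module _ (em : ExcludedMiddle 0ℓ) where

      affirm-⇔ : ∀ {m} (α : Arith k m) {ρ} → ⟪ affirm α ⟫ Xs ρ ⇔ ⟦ α ⟧ Xs ρ
      refute-⇔ : ∀ {m} (α : Arith k m) {ρ} → ⟪ refute α ⟫ Xs ρ ⇔ (¬ ⟦ α ⟧ Xs ρ)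

      affirm-⇔ (s ≐ t) = ⇔-trans (one-point λ x → value-⇔ s suc v₀ λ _ → refl)
                                 (one-point λ y → value-⇔ t suc² v₀ λ _ → refl)
      affirm-⇔ (t ∈̇ X) = ⇔-trans (one-point λ x → value-⇔ t suc v₀ λ _ → refl)
                                 (mk⇔ (from Boolₚ.T-≡) (to Boolₚ.T-≡))
      affirm-⇔ (¬̇ α)   = refute-⇔ α
      affirm-⇔ (α ∧̇ β) = affirm-⇔ α ×-⇔ affirm-⇔ β
      affirm-⇔ (α ∨̇ β) = affirm-⇔ α ⊎-⇔ affirm-⇔ β
      affirm-⇔ (∀̇ α)   = ∀-⇔ λ n → affirm-⇔ α
      affirm-⇔ (∃̇ α)   = ∃-⇔ λ n → affirm-⇔ α

      refute-⇔ (s ≐ t) = ⇔-trans (one-point λ x → value-⇔ s suc v₀ λ _ → refl)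
                                 (one-point λ y → value-⇔ t suc² v₀ λ _ → refl)
      refute-⇔ (t ∈̇ X) = ⇔-trans (one-point λ x → value-⇔ t suc v₀ λ _ → refl)
        (mk⇔ (λ eq p → true≢false (to Boolₚ.T-≡ p) eq) (λ ¬p → Boolₚ.¬-not (¬p ∘ from Boolₚ.T-≡)))
      refute-⇔ (¬̇ α) = ⇔-trans (affirm-⇔ α) (mk⇔ (λ p ¬p → ¬p p) (decidable-stable em))
      refute-⇔ (α ∧̇ β) {ρ} = ⇔-trans (refute-⇔ α ⊎-⇔ refute-⇔ β)
        (mk⇔ (λ { (inj₁ ¬a) (a , _) → ¬a a ; (inj₂ ¬b) (_ , b) → ¬b b }) split)
        where
        split : ¬ (⟦ α ⟧ Xs ρ × ⟦ β ⟧ Xs ρ) → (¬ ⟦ α ⟧ Xs ρ) ⊎ (¬ ⟦ β ⟧ Xs ρ)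
        split ¬ab with em {P = ⟦ α ⟧ Xs ρ}
        ... | yes a = inj₂ λ b → ¬ab (a , b)
        ... | no ¬a = inj₁ ¬a
      refute-⇔ (α ∨̇ β) = ⇔-trans (refute-⇔ α ×-⇔ refute-⇔ β)
        (mk⇔ (λ (¬a , ¬b) → [ ¬a , ¬b ]′) (λ ¬ab → ¬ab ∘ inj₁ , ¬ab ∘ inj₂))
      refute-⇔ (∀̇ α) {ρ} = ⇔-trans (∃-⇔ λ n → refute-⇔ α)
        (mk⇔ (λ (n , ¬a) all → ¬a (all n)) (λ ¬all → decidable-stable em λ none →
          ¬all λ n → decidable-stable em λ ¬a → none (n , ¬a)))
      refute-⇔ (∃̇ α) = ⇔-trans (∀-⇔ λ n → refute-⇔ α) (mk⇔ (λ none (n , a) → none n a) (λ ¬some n a → ¬some (n , a)))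

-- Words that carry sets and marks, and the final reduction

bit : Bool → Fin 2
bit false = zero
bit true  = suc zero

isOne : Fin 2 → Bool
isOne zero    = false
isOne (suc _) = true

isOne-bit : ∀ b → isOne (bit b) ≡ b
isOne-bit false = refl
isOne-bit true  = refl

module Main {k : ℕ} (α : Arith k 1) where

  -- A letter is a vector of `suc k` bits: first the mark, then one bit for each set variable.
  mark : Fin (2 ^ suc k) → Bool
  mark a = isOne (finToFun {2} {suc k} a zero)

  member : Fin k → Fin (2 ^ suc k) → Bool
  member X a = isOne (finToFun {2} {suc k} a (suc X))

  open Compilation {2 ^ suc k} mark member

  φ : Walk (2 ^ suc k)
  φ = growing ∧ʷ compile (affirm α)

  -- The successor makes room for the walker type `zero`; the default letter has all bits 0.
  open Structure (suc (width φ)) (2 ^ suc k) zero (funToFin {suc k} {2} (λ _ → zero))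
  open Reduction φ

  module _ (em : ExcludedMiddle 0ℓ) (ext : Extensionality 0ℓ 0ℓ) where

    env : ∀ {w} (t : Triangular (M w)) n → Env w t (placed n) (n ∷ [])
    env t n = (λ { zero → refl }) , λ { (suc _) _ → refl }

    walk-⇔ : ∀ n → (Σ[ Xs ∈ (Fin k → ℕ → Bool) ] ⟦ α ⟧ Xs (n ∷ [])) ⇔ (∃[ w ] Sat w (placed n) φ)
    walk-⇔ n = mk⇔ forth back
      where
      back : (∃[ w ] Sat w (placed n) φ) → Σ[ Xs ∈ (Fin k → ℕ → Bool) ] ⟦ α ⟧ Xs (n ∷ [])
      back (w , grows , s) = (λ X j → member X (w j)) ,
        to (affirm-⇔ em α) (to (compile-⇔ w t (affirm α) (env {w} t n)) s)
        where
        t : Triangular (M w)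
        t = to growing⇔triangular (to (growing-⇔ w n) grows)
      forth : (Σ[ Xs ∈ (Fin k → ℕ → Bool) ] ⟦ α ⟧ Xs (n ∷ [])) → ∃[ w ] Sat w (placed n) φ
      forth (Xs , a) = w , from (growing-⇔ w n) (from growing⇔triangular t) ,
        from (compile-⇔ w t (affirm α) (env {w} t n))
          (from (affirm-⇔ em α) (subst (λ Xs → ⟦ α ⟧ Xs (n ∷ [])) (sym members) a))
        where
        marks : ℕ → Bool
        marks = proj₁ (triangular-exists em)
        bits : ℕ → Fin (suc k) → Fin 2
        bits j zero    = bit (marks j)
        bits j (suc X) = bit (Xs X j)
        w : ℕ → Fin (2 ^ suc k)
        w j = funToFin (bits j)
        t : Triangular (M w)
        -- Decoding the letters returns the chosen bits pointwise; extensionality makes this an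
        -- equality of functions, along which `Triangular` is transported.
        t = subst Triangular (ext λ j → sym (trans (cong isOne (finToFun-funToFin (bits j) zero)) (isOne-bit (marks j))))
              (proj₂ (triangular-exists em))
        members : (λ X j → member X (w j)) ≡ Xs
        members = ext λ X → ext λ j → trans (cong isOne (finToFun-funToFin (bits j) (suc X))) (isOne-bit (Xs X j))

    reducible : Σ[ f ∈ (ℕ → Instance) ] Computable (λ n → Injection.to encoding (f n)) ×
                (∀ n → (Σ[ Xs ∈ (Fin k → ℕ → Bool) ] ⟦ α ⟧ Xs (n ∷ [])) ⇔ ModelChecking (f n))
    reducible = (λ n → sentence n , K) , instance-computable sentence K sentence-computable ,
                λ n → ⇔-trans (walk-⇔ n) (correct em (n≤1+n (width φ)) n)

theorem5p2 : ExcludedMiddle 0ℓ → Extensionality 0ℓ 0ℓ → Σ¹₁-Hard encoding ModelChecking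
theorem5p2 em ext A (_ , α , A⇔) =
  let f , computable , f⇔ = Main.reducible α em ext in f , computable , λ n → ⇔-trans (A⇔ n) (f⇔ n)
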